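{- Let $n\geq 1$ and $w\in S_n$. Let $\nu_w:=\mathfrak S_w(1,1,\ldots,1)$ be the Schubert polynomial of $w$ evaluated with all variables equal to $1$, and let $\eta_w:=\#\{(i,j,k): 1\leq i<j<k\leq n \text{ and } w(i)<w(k)<w(j)\}$ be the number of occurrences of the pattern $132$ in $w$. Then $\nu_w\geq \eta_w+1$.
   Context: Schubert polynomials (Lascoux–Schützenberger): for the longest permutation $w_0=n\,n-1\,\ldots\,1\in S_n$, set $\mathfrak S_{w_0}:=x_1^{n-1}x_2^{n-2}\cdots x_{n-1}$. For any other $w\in S_n$ choose $i$ with $w(i)<w(i+1)$ and set $\mathfrak S_w:=\partial_i\mathfrak S_{ws_i}$, where $s_i=(i,i+1)$, $\partial_i f:=\frac{f-s_if}{x_i-x_{i+1}}$, and $s_i$ acts on polynomials by exchanging $x_i$ and $x_{i+1}$ (this is well defined). -}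

module Defs where

open import Data.Nat as ℕ using (ℕ; zero; suc; _∸_; _*_)
open import Data.Fin as Fin using (Fin; toℕ)
open import Data.Fin.Properties using () renaming (_≟_ to _≟ᶠ_)
open import Data.Fin.Permutation using (Permutation′; _⟨$⟩ʳ_)
open import Data.Integer as ℤ using (ℤ; +_; -_)
open import Data.List as List using (List; []; _∷_; _++_; concatMap; allFin; upTo; length; filter)
open import Data.Product using (_×_; _,_)
open import Data.Maybe using (Maybe; just; nothing)
open import Relation.Nullary using (yes; no)
open import Relation.Nullary.Decidable using (⌊_⌋)
open import Data.Bool using (Bool; true; false; if_then_else_; _∧_)

-- Polynomials in x_1,…,x_n with integer coefficients, represented as a
-- (not necessarily normalised) formal sum of terms  c · x^a,
-- where the exponent vector a : Fin n → ℕ  (variable x_{k+1} ↔ index k).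
Mono : ℕ → Set
Mono n = Fin n → ℕ

Poly : ℕ → Set
Poly n = List (ℤ × Mono n)

swapFin : ∀ {n} → Fin n → Fin n → Fin n → Fin n
swapFin i j k with k ≟ᶠ i
... | yes _ = j
... | no _ with k ≟ᶠ j
...   | yes _ = i
...   | no _ = k

setExp : ∀ {n} → Fin n → ℕ → Fin n → ℕ → Mono n → Mono n
setExp i p j q a k with k ≟ᶠ i
... | yes _ = p
... | no _ with k ≟ᶠ j
...   | yes _ = q
...   | no _ = a k

-- Divided difference ∂ f = (f - s f)/(x_i - x_j) for adjacent j = i+1,
-- computed monomialwise.  For a monomial with x_i^p x_j^q (other
-- variables untouched) the exact quotient is
--   p > q :   Σ_{k<p-q}  x_i^{p-1-k} x_j^{q+k}
--   p = q :   0
--   p < q : - Σ_{k<q-p}  x_i^{q-1-k} x_j^{p+k}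
∂term : ∀ {n} → Fin n → Fin n → ℤ × Mono n → Poly n
∂term i j (c , a) with a i | a j | ℕ.compare (a i) (a j)
... | p | .(suc (p ℕ.+ d)) | ℕ.less .p d =
  List.map (λ k → (- c , setExp i (p ℕ.+ d ∸ k) j (p ℕ.+ k) a)) (upTo (suc d))
... | p | .p | ℕ.equal .p = []
... | .(suc (q ℕ.+ d)) | q | ℕ.greater .q d =
  List.map (λ k → (c , setExp i (q ℕ.+ d ∸ k) j (q ℕ.+ k) a)) (upTo (suc d))

∂ : ∀ {n} → Fin n → Fin n → Poly n → Poly n
∂ i j f = concatMap (∂term i j) f

-- x_1^{n-1} x_2^{n-2} ⋯ x_{n-1}  (the Schubert polynomial of w₀)
staircase : (n : ℕ) → Poly n
staircase n = (+ 1 , λ k → n ∸ suc (toℕ k)) ∷ []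

firstAscent : ∀ {n} → (Fin n → Fin n) → Maybe (Fin n × Fin n)
firstAscent {n} w = go (concatMap (λ i → List.map (λ j → (i , j)) (allFin n)) (allFin n))
  where
  go : List (Fin n × Fin n) → Maybe (Fin n × Fin n)
  go [] = nothing
  go ((i , j) ∷ rest) with toℕ j ℕ.≟ suc (toℕ i) | w i Fin.<? w j
  ... | yes _ | yes _ = just (i , j)
  ... | _ | _ = go rest

-- S_w = ∂_i S_{w s_i} for the first ascent i of w; S_{w₀} = staircase.
-- Each step increases the number of inversions by one, so fuel ≥ n*n
-- (which exceeds the number of non-inversions) is always sufficient and
-- the final fallback branch is reached only for w = w₀ (no ascent).
schubertAux : ∀ {n} → ℕ → (Fin n → Fin n) → Poly n
schubertAux {n} zero w = staircase n
schubertAux {n} (suc fuel) w with firstAscent w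
... | nothing = staircase n
... | just (i , j) = ∂ i j (schubertAux fuel (λ k → w (swapFin i j k)))

schubert : ∀ {n} → Permutation′ n → Poly n
schubert {n} w = schubertAux (n * n) (w ⟨$⟩ʳ_)

evalOnes : ∀ {n} → Poly n → ℤ
evalOnes [] = + 0
evalOnes ((c , _) ∷ f) = c ℤ.+ evalOnes f

ν : ∀ {n} → Permutation′ n → ℤ
ν w = evalOnes (schubert w)

η : ∀ {n} → Permutation′ n → ℕ
η {n} w = length (filter isPat triples)
  where
  triples : List (Fin n × Fin n × Fin n)
  triples = concatMap (λ i → concatMap (λ j → List.map (λ k → (i , j , k)) (allFin n)) (allFin n)) (allFin n)
  isPat : (t : Fin n × Fin n × Fin n) → _
  isPat (i , j , k) =
    let v = w ⟨$⟩ʳ_ in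
    i Fin.<? j Relation.Nullary.Decidable.×-dec
    (j Fin.<? k Relation.Nullary.Decidable.×-dec
    (v i Fin.<? v k Relation.Nullary.Decidable.×-dec v k Fin.<? v j))

{-# OPTIONS --safe #-}

-- Let i be the first position at which w differs from the longest permutation w₀. Then
--   x_i 𝔖_w = Σ_j 𝔖_{w t_ij},
-- the sum running over all j > i for which w t_ij covers w in Bruhat order, so that ν_w is the sum of
-- the ν_{w t_ij}. Two of these covers suffice for the bound. Let w(j) be the smallest value larger than
-- w(i), and w(f) the first such value after position i. Passing from w to w t_ij destroys only the
-- c patterns 132 formed by w(i), w(j) and one of the c larger entries in between. If f ≠ j, then in
-- w t_if the value w(i), now at position f, forms a 132 with w(j) and each of these entries but w(f),
-- so w t_if contains at least c - 1 patterns; if f = j, then c = 0. Induction towards w₀ concludes.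
--
-- Polynomials are compared as functions ℤⁿ → ℤ. A polynomial function preserves congruences, and this
-- is enough to cancel the factor x_i - x_j, also at points where it vanishes. Hence divided differences
-- are characterised by (x_i - x_j) ∂f = f - s f, the braid relations follow, and 𝔖_w may be computed
-- from any ascent of w. The displayed formula is then proved by descending from w₀: an ascent r > i
-- is removed by applying ∂_r to both sides; if there is none, w decreases after position i, and
-- x_i ∂_i F = F + ∂_i (x_{i+1} F) reduces the formula for (w, i) to the one for (w s_i, i+1).
module Submission where

open import Defs
open import Algebra.Bundles using (CommutativeMonoid)
open import Data.Bool using (if_then_else_)
open import Data.Empty using (⊥; ⊥-elim)
open import Data.Fin as Fin using (Fin; zero; suc; toℕ)
open import Data.Fin.Permutation using (Permutation′; permutation; _⟨$⟩ʳ_)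
import Data.Fin.Properties as Finₚ
open import Data.Fin.Properties using (any?; all?)
open import Data.Integer using (ℤ; +_; -_; _+_; _*_; _-_; _^_; 0ℤ; 1ℤ; ∣_∣) renaming (_≤_ to _≤ℤ_)
import Data.Integer as ℤ
open import Data.Integer.Divisibility.Signed using (_∣_; divides; ∣m∣n⇒∣m+n; ∣m⇒∣-m; ∣m∣n⇒∣m-n; ∣n⇒∣m*n; ∣m⇒∣m*n; 0∣⇒≡0; ∣⇒∣ᵤ)
import Data.Integer.Properties as ℤₚ
open import Data.Integer.Tactic.RingSolver using (solve-∀)
open import Data.List as List using (List; []; _∷_; _++_; allFin; applyUpTo; concatMap; filter; length; upTo)
open import Data.List.Membership.Propositional using (_∈_)
open import Data.List.Membership.Propositional.Properties using (∈-concatMap⁺; ∈-map⁺; ∈-allFin)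
open import Data.List.Properties using (length-++; filter-++)
open import Data.List.Relation.Unary.Any as Any using (here; there)
open import Data.Maybe using (Maybe; just; nothing)
open import Data.Nat as ℕ using (ℕ; zero; suc; z≤n; s≤s; _≤_)
import Data.Nat.Divisibility as ℕ∣
import Data.Nat.Properties as ℕₚ
open import Data.Nat.Tactic.RingSolver using () renaming (solve-∀ to solve-∀ℕ)
open import Data.Product using (_×_; _,_; proj₁; proj₂; ∃)
open import Function using (_∘_; id; const)
open import Function.Bundles using (Injection)
open import Function.Definitions using (Injective)
open import Function.Properties.Inverse using (↔⇒↣)
open import Level using (Level)
open import Relation.Binary.PropositionalEquality
open import Relation.Nullary using (¬_; Dec; yes; no; contradiction)
open import Relation.Nullary.Decidable using (_×-dec_; _→-dec_; ¬?; does)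
open import Relation.Unary using (Decidable)
open import Algebra.Properties.CommutativeMonoid.Sum ℕₚ.+-0-commutativeMonoid using () renaming (sum to sumℕ; sum-cong-≗ to sumℕ-cong; sum-permute to sumℕ-permute; ∑-distrib-+ to sumℕ-distrib-+)
open import Algebra.Properties.CommutativeMonoid.Sum ℤₚ.+-0-commutativeMonoid using () renaming (sum to sumℤ; sum-cong-≗ to sumℤ-cong; sum-permute to sumℤ-permute; sum-replicate-zero to sumℤ-zero)
open import Algebra.Properties.CommutativeMonoid.Sum ℤₚ.*-1-commutativeMonoid using () renaming (sum to prodℤ)

-- Transpositions of indices

swap-left : ∀ {n} (i j : Fin n) → swapFin i j i ≡ j
swap-left i j with i Finₚ.≟ i
... | yes _ = refl
... | no i≢i = contradiction refl i≢i

swap-right : ∀ {n} (i j : Fin n) → swapFin i j j ≡ i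
swap-right i j with j Finₚ.≟ i
... | yes j≡i = j≡i
... | no _ with j Finₚ.≟ j
...   | yes _ = refl
...   | no j≢j = contradiction refl j≢j

swap-other : ∀ {n} {i j k : Fin n} → k ≢ i → k ≢ j → swapFin i j k ≡ k
swap-other {i = i} {j} {k} k≢i k≢j with k Finₚ.≟ i
... | yes k≡i = contradiction k≡i k≢i
... | no _ with k Finₚ.≟ j
...   | yes k≡j = contradiction k≡j k≢j
...   | no _ = refl

swap-elim : ∀ {n} {i j : Fin n} (P : Fin n → Set) → P i → P j →
            (∀ {k} → k ≢ i → k ≢ j → P k) → ∀ k → P k
swap-elim {i = i} {j} P Pi Pj Po k with k Finₚ.≟ i | k Finₚ.≟ j
... | yes refl | _ = Pi
... | no _ | yes refl = Pj
... | no k≢i | no k≢j = Po k≢i k≢j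

-- Injectivity keeps every index other than `i` and `j` away from `σ i` and `σ j`. The commutation
-- and braid relations below come from taking `σ` to be a transposition itself.
swap-conj : ∀ {n} (σ : Fin n → Fin n) → Injective _≡_ _≡_ σ →
            ∀ i j k → σ (swapFin i j k) ≡ swapFin (σ i) (σ j) (σ k)
swap-conj σ inj i j = swap-elim (λ k → σ (swapFin i j k) ≡ swapFin (σ i) (σ j) (σ k))
  (trans (cong σ (swap-left i j)) (sym (swap-left (σ i) (σ j))))
  (trans (cong σ (swap-right i j)) (sym (swap-right (σ i) (σ j))))
  (λ k≢i k≢j → trans (cong σ (swap-other k≢i k≢j))
                     (sym (swap-other (k≢i ∘ inj) (k≢j ∘ inj))))

swap-involutive : ∀ {n} (i j k : Fin n) → swapFin i j (swapFin i j k) ≡ k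
swap-involutive i j = swap-elim (λ k → swapFin i j (swapFin i j k) ≡ k)
  (trans (cong (swapFin i j) (swap-left i j)) (swap-right i j))
  (trans (cong (swapFin i j) (swap-right i j)) (swap-left i j))
  (λ k≢i k≢j → trans (cong (swapFin i j) (swap-other k≢i k≢j)) (swap-other k≢i k≢j))

swap-injective : ∀ {n} (i j : Fin n) {a b} → swapFin i j a ≡ swapFin i j b → a ≡ b
swap-injective i j {a} {b} eq =
  trans (sym (swap-involutive i j a)) (trans (cong (swapFin i j) eq) (swap-involutive i j b))

swap-commute : ∀ {n} {i j k l : Fin n} → k ≢ i → k ≢ j → l ≢ i → l ≢ j →
               ∀ m → swapFin i j (swapFin k l m) ≡ swapFin k l (swapFin i j m)
swap-commute {i = i} {j} {k} {l} k≢i k≢j l≢i l≢j m =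
  trans (swap-conj (swapFin i j) (swap-injective i j) k l m)
        (cong₂ (λ a b → swapFin a b (swapFin i j m)) (swap-other k≢i k≢j) (swap-other l≢i l≢j))

-- Both sides are the transposition of `i` and `k`, obtained by conjugating one of the two
-- transpositions by the other.
swap-braid : ∀ {n} {i j k : Fin n} → i ≢ j → j ≢ k → i ≢ k → ∀ m →
             swapFin i j (swapFin j k (swapFin i j m)) ≡ swapFin j k (swapFin i j (swapFin j k m))
swap-braid {i = i} {j} {k} i≢j j≢k i≢k m = trans left (sym right)
  where
  left : swapFin i j (swapFin j k (swapFin i j m)) ≡ swapFin i k m
  left = trans (swap-conj (swapFin i j) (swap-injective i j) j k (swapFin i j m))
    (trans (cong₂ (λ a b → swapFin a b (swapFin i j (swapFin i j m)))
                  (swap-right i j) (swap-other (i≢k ∘ sym) (j≢k ∘ sym)))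
           (cong (swapFin i k) (swap-involutive i j m)))
  right : swapFin j k (swapFin i j (swapFin j k m)) ≡ swapFin i k m
  right = trans (swap-conj (swapFin j k) (swap-injective j k) i j (swapFin j k m))
    (trans (cong₂ (λ a b → swapFin a b (swapFin j k (swapFin j k m)))
                  (swap-other i≢j i≢k) (swap-left j k))
           (cong (swapFin i k) (swap-involutive j k m)))

-- Sums and products with one or two exceptional indices

module TwoIndices {a ℓ : Level} (M : CommutativeMonoid a ℓ) where
  open CommutativeMonoid M renaming (refl to ≈-refl; sym to ≈-sym; trans to ≈-trans)
  open import Algebra.Properties.CommutativeMonoid.Sum M using (sum; sum-cong-≋)
  open import Algebra.Properties.CommutativeSemigroup commutativeSemigroup using (x∙yz≈y∙xz)

  sum-one : ∀ {n} {f g : Fin n → Carrier} (i : Fin n) →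
            (∀ k → k ≢ i → f k ≈ g k) → g i ≈ ε → sum f ≈ f i ∙ sum g
  sum-one zero f≈g gi≈ε = ∙-congˡ (≈-trans (sum-cong-≋ (λ k → f≈g (suc k) λ ()))
    (≈-sym (≈-trans (∙-congʳ gi≈ε) (identityˡ _))))
  sum-one (suc i) f≈g gi≈ε = ≈-trans
    (∙-cong (f≈g zero λ ()) (sum-one i (λ k k≢i → f≈g (suc k) (k≢i ∘ Finₚ.suc-injective)) gi≈ε))
    (x∙yz≈y∙xz _ _ _)

  -- Neutral entries of `g` at `i` and `j` replace the deletion of these indices, so that all sums
  -- run over the same `Fin n`.
  sum-two : ∀ {n} {f g : Fin n → Carrier} {i j : Fin n} → i ≢ j →
            (∀ k → k ≢ i → k ≢ j → f k ≈ g k) → g i ≈ ε → g j ≈ ε →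
            sum f ≈ f i ∙ (f j ∙ sum g)
  sum-two {n} {f} {g} {i} {j} i≢j f≈g gi≈ε gj≈ε =
    ≈-trans (sum-one i f≈h hi≈ε) (∙-congˡ (≈-trans (sum-one j h≈g gj≈ε) (∙-congʳ hj≈fj)))
    where
    -- `h` neutralises the entry at `i` only; `sum-one` leads from `f` to `h` and then from `h` to
    -- `g`.
    h : Fin n → Carrier
    h k with k Finₚ.≟ i
    ... | yes _ = ε
    ... | no _ = f k
    f≈h : ∀ k → k ≢ i → f k ≈ h k
    f≈h k k≢i with k Finₚ.≟ i
    ... | yes k≡i = contradiction k≡i k≢i
    ... | no _ = ≈-refl
    hi≈ε : h i ≈ ε
    hi≈ε with i Finₚ.≟ i
    ... | yes _ = ≈-refl
    ... | no i≢i = contradiction refl i≢i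
    hj≈fj : h j ≈ f j
    hj≈fj = ≈-sym (f≈h j (i≢j ∘ sym))
    h≈g : ∀ k → k ≢ j → h k ≈ g k
    h≈g k k≢j with k Finₚ.≟ i
    ... | yes refl = ≈-sym gi≈ε
    ... | no k≢i = f≈g k k≢i k≢j

open TwoIndices ℕₚ.+-0-commutativeMonoid using () renaming (sum-two to sumℕ-two)
open TwoIndices ℤₚ.+-0-commutativeMonoid using () renaming (sum-one to sumℤ-one)
open TwoIndices ℤₚ.*-1-commutativeMonoid using () renaming (sum-two to prodℤ-two)

-- Divided differences of congruence-preserving functions

Fun : ℕ → Set
Fun n = (Fin n → ℤ) → ℤ

record CongruencePreserving {n} (F : Fun n) : Set where
  constructor cp
  field
    preserves : ∀ {m x y} → (∀ k → m ∣ x k - y k) → m ∣ F x - F y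
open CongruencePreserving

m∣0 : ∀ {m} → m ∣ 0ℤ
m∣0 = divides 0ℤ refl

cp-const : ∀ {n} (c : ℤ) → CongruencePreserving {n} (const c)
cp-const c = cp λ _ → subst (_ ∣_) (sym (ℤₚ.+-inverseʳ c)) m∣0

cp-var : ∀ {n} (k : Fin n) → CongruencePreserving (λ x → x k)
cp-var k = cp λ h → h k

cp-+ : ∀ {n} {F G : Fun n} → CongruencePreserving F → CongruencePreserving G →
       CongruencePreserving (λ x → F x + G x)
cp-+ {F = F} {G} cF cG = cp λ {m} {x} {y} h →
  subst (m ∣_) (rearrange (F x) (F y) (G x) (G y)) (∣m∣n⇒∣m+n (preserves cF h) (preserves cG h))
  where
  rearrange : ∀ a b c d → (a - b) + (c - d) ≡ (a + c) - (b + d)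
  rearrange = solve-∀

cp-* : ∀ {n} {F G : Fun n} → CongruencePreserving F → CongruencePreserving G →
       CongruencePreserving (λ x → F x * G x)
cp-* {F = F} {G} cF cG = cp λ {m} {x} {y} h →
  subst (m ∣_) (rearrange (F x) (F y) (G x) (G y))
    (∣m∣n⇒∣m+n (∣n⇒∣m*n (F x) (preserves cG h)) (∣m⇒∣m*n (G y) (preserves cF h)))
  where
  rearrange : ∀ a b c d → a * (c - d) + (a - b) * d ≡ a * c - b * d
  rearrange = solve-∀

cp-neg : ∀ {n} {F : Fun n} → CongruencePreserving F → CongruencePreserving (λ x → - F x)
cp-neg {F = F} cF = cp λ {m} {x} {y} h →
  subst (m ∣_) (rearrange (F x) (F y)) (∣m⇒∣-m (preserves cF h))
  where
  rearrange : ∀ a b → - (a - b) ≡ - a - (- b)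
  rearrange = solve-∀

cp-^ : ∀ {n} {F : Fun n} → CongruencePreserving F → ∀ e → CongruencePreserving (λ x → F x ^ e)
cp-^ cF zero = cp-const 1ℤ
cp-^ cF (suc e) = cp-* cF (cp-^ cF e)

cp-prod : ∀ {m n} {F : Fin m → Fun n} → (∀ k → CongruencePreserving (F k)) →
          CongruencePreserving (λ x → prodℤ (λ k → F k x))
cp-prod {zero} cF = cp-const 1ℤ
cp-prod {suc m} cF = cp-* (cF zero) (cp-prod (cF ∘ suc))

cp-sum : ∀ {m n} {F : Fin m → Fun n} → (∀ k → CongruencePreserving (F k)) →
         CongruencePreserving (λ x → sumℤ (λ k → F k x))
cp-sum {zero} cF = cp-const 0ℤ
cp-sum {suc m} cF = cp-+ (cF zero) (cp-sum (cF ∘ suc))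

cp-swap : ∀ {n} {F : Fun n} → CongruencePreserving F → ∀ i j → CongruencePreserving (λ x → F (x ∘ swapFin i j))
cp-swap cF i j = cp λ h → preserves cF (λ k → h (swapFin i j k))

-- Divisibility by 0 is equality, so the congruence at modulus 0 is invariance under pointwise
-- equality of points.
cp-ext : ∀ {n} {F : Fun n} → CongruencePreserving F → ∀ {x y} → x ≗ y → F x ≡ F y
cp-ext {F = F} cF {x} {y} x≗y = ℤₚ.i-j≡0⇒i≡j (F x) (F y)
  (0∣⇒≡0 (preserves cF (λ k → subst (0ℤ ∣_) (sym (ℤₚ.i≡j⇒i-j≡0 (x≗y k))) m∣0)))

δ : ∀ {n} → Fin n → Fin n → Fun n
δ i j x = x i - x j

cp-δ* : ∀ {n} (i j : Fin n) {F : Fun n} → CongruencePreserving F → CongruencePreserving (λ x → δ i j x * F x)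
cp-δ* i j = cp-* (cp-+ (cp-var i) (cp-neg (cp-var j)))

-- A point where δ vanishes is moved off the diagonal by a step m so large that
-- divisibility of F x - G x by m forces F x ≡ G x.
δ-cancel : ∀ {n} {i j : Fin n} → i ≢ j → {F G : Fun n} → CongruencePreserving F → CongruencePreserving G →
           (∀ x → δ i j x * F x ≡ δ i j x * G x) → F ≗ G
δ-cancel {n} {i} {j} i≢j {F} {G} cF cG eq x = ℤₚ.i-j≡0⇒i≡j (F x) (G x) (ℤₚ.∣i∣≡0⇒i≡0 ∣D∣≡0)
  where
  D = F x - G x
  m = suc (∣ δ i j x ∣ ℕ.+ ∣ D ∣)
  y : Fin n → ℤ
  y k with k Finₚ.≟ i
  ... | yes _ = x k + + m
  ... | no _ = x k
  yi : y i ≡ x i + + m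
  yi with i Finₚ.≟ i
  ... | yes _ = refl
  ... | no i≢i = contradiction refl i≢i
  yj : y j ≡ x j
  yj with j Finₚ.≟ i
  ... | yes j≡i = contradiction (sym j≡i) i≢j
  ... | no _ = refl
  cong-mod : ∀ k → + m ∣ x k - y k
  cong-mod k with k Finₚ.≟ i
  ... | yes _ = divides (- 1ℤ) (lemma (x k) (+ m))
    where
    lemma : ∀ a b → a - (a + b) ≡ - 1ℤ * b
    lemma = solve-∀
  ... | no _ = subst (_ ∣_) (sym (ℤₚ.+-inverseʳ (x k))) m∣0
  δy : δ i j y ≡ δ i j x + + m
  δy = trans (cong₂ _-_ yi yj) (lemma (x i) (x j) (+ m))
    where
    lemma : ∀ a b c → (a + c) - b ≡ (a - b) + c
    lemma = solve-∀
  δy≢0 : δ i j y ≢ 0ℤ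
  δy≢0 δy≡0 = ℕₚ.<-irrefl
    (cong ∣_∣ (ℤₚ.i-j≡0⇒i≡j (δ i j x) (- + m) (trans (sym δy) δy≡0)))
    (s≤s (ℕₚ.m≤m+n _ _))
  FGy : F y ≡ G y
  FGy = ℤₚ.*-cancelˡ-≡ (δ i j y) (F y) (G y) {{ℤ.≢-nonZero δy≢0}} (eq y)
  m∣D : + m ∣ D
  m∣D = subst (+ m ∣_)
    (trans (cong (λ g → (F x - F y) - (G x - g)) (sym FGy)) (lemma (F x) (F y) (G x)))
    (∣m∣n⇒∣m-n (preserves cF cong-mod) (preserves cG cong-mod))
    where
    lemma : ∀ a b c → (a - b) - (c - b) ≡ a - c
    lemma = solve-∀
  ∣D∣≡0 : ∣ D ∣ ≡ 0
  ∣D∣≡0 with ∣ D ∣ in e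
  ... | zero = refl
  ... | suc d = contradiction
    (ℕ∣.∣⇒≤ (subst (m ℕ∣.∣_) e (∣⇒∣ᵤ m∣D)))
    (ℕₚ.<⇒≱ (s≤s (subst (ℕ._≤ ∣ δ i j x ∣ ℕ.+ ∣ D ∣) e (ℕₚ.m≤n+m ∣ D ∣ ∣ δ i j x ∣))))

-- `G` is the divided difference of `F`, given by the equation cleared of its denominator. That
-- equation leaves the values of `G` on the diagonal free; the congruences determine them, by
-- `δ-cancel`.
record IsD {n} (i j : Fin n) (F G : Fun n) : Set where
  field
    cpᶠ : CongruencePreserving F
    cpᵍ : CongruencePreserving G
    eq  : ∀ x → δ i j x * G x ≡ F x - F (x ∘ swapFin i j)
open IsD public

isD-unique : ∀ {n} {i j : Fin n} {F G H : Fun n} → i ≢ j → IsD i j F G → IsD i j F H → G ≗ H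
isD-unique i≢j d e = δ-cancel i≢j (cpᵍ d) (cpᵍ e) (λ x → trans (eq d x) (sym (eq e x)))

isD-resp : ∀ {n} {i j : Fin n} {F F′ G G′ : Fun n} → CongruencePreserving F′ → CongruencePreserving G′ →
           F ≗ F′ → G ≗ G′ →
           IsD i j F G → IsD i j F′ G′
isD-resp {i = i} {j} cF cG F≗F′ G≗G′ d = record
  { cpᶠ = cF ; cpᵍ = cG
  ; eq = λ x → trans (cong (δ i j x *_) (sym (G≗G′ x)))
      (trans (eq d x) (cong₂ _-_ (F≗F′ x) (F≗F′ _))) }

difference-+ : ∀ a b c p q r s → a * b ≡ p - q → a * c ≡ r - s → a * (b + c) ≡ (p + r) - (q + s)
difference-+ a b c p q r s h k = trans (ℤₚ.*-distribˡ-+ a b c) (trans (cong₂ _+_ h k) (lemma p q r s))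
  where
  lemma : ∀ p q r s → (p - q) + (r - s) ≡ (p + r) - (q + s)
  lemma = solve-∀

isD-sum : ∀ {m n} {i j : Fin n} {F G : Fin m → Fun n} → (∀ k → IsD i j (F k) (G k)) →
          IsD i j (λ x → sumℤ (λ k → F k x)) (λ x → sumℤ (λ k → G k x))
isD-sum {F = F} {G} d = record
  { cpᶠ = cp-sum (λ k → cpᶠ (d k)) ; cpᵍ = cp-sum (λ k → cpᵍ (d k)) ; eq = λ x → go d x }
  where
  go : ∀ {m n} {i j : Fin n} {F G : Fin m → Fun n} → (∀ k → IsD i j (F k) (G k)) → ∀ x →
       δ i j x * sumℤ (λ k → G k x) ≡ sumℤ (λ k → F k x) - sumℤ (λ k → F k (x ∘ swapFin i j))
  go {zero} {i = i} {j} d x = ℤₚ.*-zeroʳ (δ i j x)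
  go {suc m} {i = i} {j} {F} {G} d x = difference-+ (δ i j x)
    (G zero x) (sumℤ (λ k → G (suc k) x)) (F zero x) (F zero (x ∘ swapFin i j))
    (sumℤ (λ k → F (suc k) x)) (sumℤ (λ k → F (suc k) (x ∘ swapFin i j)))
    (eq (d zero) x) (go (d ∘ suc) x)

isD-scale : ∀ {n} {i j : Fin n} {F G : Fun n} (c : ℤ) → IsD i j F G →
            IsD i j (λ x → c * F x) (λ x → c * G x)
isD-scale {i = i} {j} {F} {G} c d = record
  { cpᶠ = cp-* (cp-const c) (cpᶠ d) ; cpᵍ = cp-* (cp-const c) (cpᵍ d)
  ; eq = λ x → trans (left (δ i j x) c (G x)) (trans (cong (c *_) (eq d x)) (right c _ _)) }
  where
  left : ∀ a c g → a * (c * g) ≡ c * (a * g)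
  left = solve-∀
  right : ∀ c f g → c * (f - g) ≡ c * f - c * g
  right = solve-∀

isD-var : ∀ {n} {i j k : Fin n} {F G : Fun n} → k ≢ i → k ≢ j → IsD i j F G →
          IsD i j (λ x → x k * F x) (λ x → x k * G x)
isD-var {i = i} {j} {k} {F} {G} k≢i k≢j d = record
  { cpᶠ = cp-* (cp-var k) (cpᶠ d) ; cpᵍ = cp-* (cp-var k) (cpᵍ d)
  ; eq = λ x → trans (left (δ i j x) (x k) (G x)) (trans (cong (x k *_) (eq d x))
      (trans (right (x k) _ _)
        (cong (λ l → x k * F x - x l * F (x ∘ swapFin i j)) (sym (swap-other k≢i k≢j))))) }
  where
  left : ∀ a c g → a * (c * g) ≡ c * (a * g)
  left = solve-∀
  right : ∀ c f g → c * (f - g) ≡ c * f - c * g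
  right = solve-∀

-- x_i ∂F = F + ∂ (x_j F)
isD-leibniz : ∀ {n} {i j : Fin n} {F G : Fun n} → IsD i j F G →
              IsD i j (λ x → x j * F x) (λ x → x i * G x - F x)
isD-leibniz {i = i} {j} {F} {G} d = record
  { cpᶠ = cp-* (cp-var j) (cpᶠ d)
  ; cpᵍ = cp-+ (cp-* (cp-var i) (cpᵍ d)) (cp-neg (cpᶠ d))
  ; eq = λ x → trans (left (x i) (x j) (F x) (G x))
      (trans (cong (λ t → x i * t - (x i - x j) * F x) (eq d x))
        (trans (right (x i) (x j) (F x) _)
          (cong (λ l → x j * F x - x l * F (x ∘ swapFin i j)) (sym (swap-right i j))))) }
  where
  left : ∀ a b f g → (a - b) * (a * g - f) ≡ a * ((a - b) * g) - (a - b) * f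
  left = solve-∀
  right : ∀ a b f h → a * (f - h) - (a - b) * f ≡ b * f - a * h
  right = solve-∀

isD-symmetric : ∀ {n} {i j : Fin n} {F : Fun n} → CongruencePreserving F →
                (∀ x → F (x ∘ swapFin i j) ≡ F x) → IsD i j F (const 0ℤ)
isD-symmetric {i = i} {j} {F} cF inv = record
  { cpᶠ = cF ; cpᵍ = cp-const 0ℤ
  ; eq = λ x → trans (ℤₚ.*-zeroʳ (δ i j x)) (sym (ℤₚ.i≡j⇒i-j≡0 (sym (inv x)))) }

δ-swap : ∀ {n} (i j : Fin n) x → δ i j (x ∘ swapFin i j) ≡ - δ i j x
δ-swap i j x = trans (cong₂ (λ a b → x a - x b) (swap-left i j) (swap-right i j)) (lemma (x i) (x j))
  where
  lemma : ∀ a b → b - a ≡ - (a - b)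
  lemma = solve-∀

-- Exchanging the two variables negates both `δ i j` and `F` minus its swap, so the swapped `G`
-- satisfies the same equation as `G`.
isD-image-symmetric : ∀ {n} {i j : Fin n} {F G : Fun n} → i ≢ j → IsD i j F G →
                      ∀ x → G (x ∘ swapFin i j) ≡ G x
isD-image-symmetric {i = i} {j} {F} {G} i≢j d = δ-cancel i≢j (cp-swap (cpᵍ d) i j) (cpᵍ d) step
  where
  s = swapFin i j
  negate : ∀ a g p q → - a * g ≡ p - q → a * g ≡ q - p
  negate a g p q h = trans (l1 a g) (trans (cong -_ h) (l2 p q))
    where
    l1 : ∀ a g → a * g ≡ - (- a * g)
    l1 = solve-∀
    l2 : ∀ p q → - (p - q) ≡ q - p
    l2 = solve-∀
  step : ∀ x → δ i j x * G (x ∘ s) ≡ δ i j x * G x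
  step x = trans
    (negate (δ i j x) (G (x ∘ s)) (F (x ∘ s)) (F x)
      (trans (cong (_* G (x ∘ s)) (sym (δ-swap i j x)))
        (trans (eq d (x ∘ s))
          (cong (λ t → F (x ∘ s) - t) (cp-ext (cpᶠ d) (λ k → cong x (swap-involutive i j k)))))))
    (sym (eq d x))

-- Each transposition fixes the difference belonging to the other. Multiplied by both differences,
-- either side becomes the alternating sum of `F` over the four products of the two commuting
-- transpositions.
isD-commute : ∀ {n} {i j k l : Fin n} {F A B A′ B′ : Fun n} → i ≢ j → k ≢ l →
              k ≢ i → k ≢ j → l ≢ i → l ≢ j →
              IsD i j F A → IsD k l A B → IsD k l F A′ → IsD i j A′ B′ → B ≗ B′
isD-commute {i = i} {j} {k} {l} {F} {A} {B} {A′} {B′} i≢j k≢l k≢i k≢j l≢i l≢j dA dB dA′ dB′ =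
  δ-cancel k≢l (cpᵍ dB) (cpᵍ dB′)
    (δ-cancel i≢j (cp-δ* k l (cpᵍ dB)) (cp-δ* k l (cpᵍ dB′)) step)
  where
  expand : ∀ a b {B A At f fs ft fts} → b * B ≡ A - At → a * A ≡ f - fs → a * At ≡ ft - fts →
           a * (b * B) ≡ (f - fs) - (ft - fts)
  expand a b {A = A} {At} hB hA hAt =
    trans (cong (a *_) hB) (trans (distrib a A At) (cong₂ _-_ hA hAt))
    where
    distrib : ∀ a b c → a * (b - c) ≡ a * b - a * c
    distrib = solve-∀
  regroup : ∀ f fs ft fts → (f - fs) - (ft - fts) ≡ (f - ft) - (fs - fts)
  regroup = solve-∀
  flip : ∀ a b c → a * (b * c) ≡ b * (a * c)
  flip = solve-∀
  s = swapFin i j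
  t = swapFin k l
  δ-t : ∀ x → δ i j (x ∘ t) ≡ δ i j x
  δ-t x = cong₂ (λ p q → x p - x q) (swap-other (k≢i ∘ sym) (l≢i ∘ sym))
                                    (swap-other (k≢j ∘ sym) (l≢j ∘ sym))
  δ-s : ∀ x → δ k l (x ∘ s) ≡ δ k l x
  δ-s x = cong₂ (λ p q → x p - x q) (swap-other k≢i k≢j) (swap-other l≢i l≢j)
  step : ∀ x → δ i j x * (δ k l x * B x) ≡ δ i j x * (δ k l x * B′ x)
  step x = trans
    (expand (δ i j x) (δ k l x) {A = A x} {A (x ∘ t)} {F x} {F (x ∘ s)} {F (x ∘ t)} {F (x ∘ t ∘ s)}
      (eq dB x) (eq dA x)
      (trans (cong (_* A (x ∘ t)) (sym (δ-t x))) (eq dA (x ∘ t))))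
    (trans (regroup (F x) (F (x ∘ s)) (F (x ∘ t)) (F (x ∘ t ∘ s)))
    (trans (cong (λ u → (F x - F (x ∘ t)) - (F (x ∘ s) - u))
             (cp-ext (cpᶠ dA) (λ m → cong x (sym (swap-commute k≢i k≢j l≢i l≢j m)))))
    (trans (sym (expand (δ k l x) (δ i j x)
      {A = A′ x} {A′ (x ∘ s)} {F x} {F (x ∘ t)} {F (x ∘ s)} {F (x ∘ s ∘ t)} (eq dB′ x) (eq dA′ x)
      (trans (cong (_* A′ (x ∘ s)) (sym (δ-s x))) (eq dA′ (x ∘ s)))))
      (flip (δ k l x) (δ i j x) (B′ x)))))

-- After cancelling one factor a, the right-hand side is the antisymmetrisation of f over S₃, and
-- therefore the same for ∂ᵢⱼ ∂ⱼₖ ∂ᵢⱼ and ∂ⱼₖ ∂ᵢⱼ ∂ⱼₖ.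
expand-∂∂∂ : ∀ a b c {C B Bs A At As Ast f fs ft fts fst fsts} → c ≡ a + b →
  a * C ≡ B - Bs → b * B ≡ A - At → c * Bs ≡ As - Ast →
  a * A ≡ f - fs → c * At ≡ ft - fts → - a * As ≡ fs - f → b * Ast ≡ fst - fsts →
  a * (a * (b * (c * C))) ≡ a * (((f - fs) - (ft - fts)) + (fst - fsts))
expand-∂∂∂ a b c {C} {B} {Bs} {A} {At} {As} {Ast} {f} {fs} {ft} {fts} {fst} {fsts}
    refl hC hB hBs hA hAt hAs hAst = begin
  a * (a * (b * (c * C)))                       ≡⟨ e₁ a b c C ⟩
  a * b * c * (a * C)                           ≡⟨ cong (a * b * c *_) hC ⟩
  a * b * c * (B - Bs)                          ≡⟨ e₂ a b c B Bs ⟩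
  a * c * (b * B) - a * b * (c * Bs)            ≡⟨ cong₂ (λ u v → a * c * u - a * b * v) hB hBs ⟩
  a * c * (A - At) - a * b * (As - Ast)         ≡⟨ e₃ a b c A At As Ast ⟩
  (c * (a * A) - a * (c * At)) + (b * (- a * As) + a * (b * Ast))
    ≡⟨ cong₂ _+_ (cong₂ (λ u v → c * u - a * v) hA hAt) (cong₂ (λ u v → b * u + a * v) hAs hAst) ⟩
  (c * (f - fs) - a * (ft - fts)) + (b * (fs - f) + a * (fst - fsts))
    ≡⟨ e₄ a b f fs (ft - fts) (fst - fsts) ⟩
  a * (((f - fs) - (ft - fts)) + (fst - fsts)) ∎
  where
  open ≡-Reasoning
  e₁ : ∀ a b c C → a * (a * (b * (c * C))) ≡ a * b * c * (a * C)
  e₁ = solve-∀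
  e₂ : ∀ a b c B Bs → a * b * c * (B - Bs) ≡ a * c * (b * B) - a * b * (c * Bs)
  e₂ = solve-∀
  e₃ : ∀ a b c A At As Ast → a * c * (A - At) - a * b * (As - Ast) ≡
       (c * (a * A) - a * (c * At)) + (b * (- a * As) + a * (b * Ast))
  e₃ = solve-∀
  e₄ : ∀ a b f fs u v → ((a + b) * (f - fs) - a * u) + (b * (fs - f) + a * v) ≡
       a * (((f - fs) - u) + v)
  e₄ = solve-∀

isD-braid : ∀ {n} {i j k : Fin n} {F A B C A′ B′ C′ : Fun n} → i ≢ j → j ≢ k → i ≢ k →
            IsD i j F A → IsD j k A B → IsD i j B C →
            IsD j k F A′ → IsD i j A′ B′ → IsD j k B′ C′ → C ≗ C′
isD-braid {n} {i} {j} {k} {F} {A} {B} {C} {A′} {B′} {C′} i≢j j≢k i≢k dA dB dC dA′ dB′ dC′ =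
  -- The claim is multiplied by `δ i k` and the squares of `δ i j` and `δ j k`. One factor of each
  -- clears the denominators; the extra `δ i j` and `δ j k` are the factors that `expand-∂∂∂`
  -- carries for the one and the other side.
  δ-cancel i≢k cC cC′ (δ-cancel j≢k (ik cC) (ik cC′) (δ-cancel j≢k (jk (ik cC)) (jk (ik cC′))
    (δ-cancel i≢j (jk (jk (ik cC))) (jk (jk (ik cC′)))
      (δ-cancel i≢j (ij (jk (jk (ik cC)))) (ij (jk (jk (ik cC′)))) step))))
  where
  cC = cpᵍ dC
  cC′ = cpᵍ dC′
  ij : ∀ {G : Fun n} → CongruencePreserving G → CongruencePreserving (λ x → δ i j x * G x)
  ij = cp-δ* i j
  jk : ∀ {G : Fun n} → CongruencePreserving G → CongruencePreserving (λ x → δ j k x * G x)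
  jk = cp-δ* j k
  ik : ∀ {G : Fun n} → CongruencePreserving G → CongruencePreserving (λ x → δ i k x * G x)
  ik = cp-δ* i k
  s = swapFin i j
  t = swapFin j k
  si : s i ≡ j
  si = swap-left i j
  sj : s j ≡ i
  sj = swap-right i j
  sk : s k ≡ k
  sk = swap-other (i≢k ∘ sym) (j≢k ∘ sym)
  ti : t i ≡ i
  ti = swap-other i≢j i≢k
  tj : t j ≡ k
  tj = swap-left j k
  tk : t k ≡ j
  tk = swap-right j k
  at : ∀ {G H : Fun n} {p q : Fin n} → IsD p q G H → ∀ y (x : Fin n → ℤ) p′ q′ →
       y p ≡ x p′ → y q ≡ x q′ → δ p′ q′ x * H y ≡ G y - G (y ∘ swapFin p q)
  at {H = H} d y x p′ q′ yp yq = trans (cong (_* H y) (sym (cong₂ _-_ yp yq))) (eq d y)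
  negated : ∀ {G H : Fun n} {p q : Fin n} → IsD p q G H → ∀ x →
            - δ p q x * H (x ∘ swapFin p q) ≡ G (x ∘ swapFin p q) - G x
  negated {G} {H} {p} {q} d x = trans (cong (_* H (x ∘ swapFin p q)) (sym (δ-swap p q x)))
    (trans (eq d (x ∘ swapFin p q))
      (cong (λ u → G (x ∘ swapFin p q) - u) (cp-ext (cpᶠ d) (λ m → cong x (swap-involutive p q m)))))
  δ-sum : ∀ x → δ i k x ≡ δ i j x + δ j k x
  δ-sum x = telescope (x i) (x j) (x k)
    where
    telescope : ∀ a b c → a - c ≡ (a - b) + (b - c)
    telescope = solve-∀
  left : ∀ x → δ i j x * (δ i j x * (δ j k x * (δ i k x * C x))) ≡
    δ i j x * (((F x - F (x ∘ s)) - (F (x ∘ t) - F (x ∘ t ∘ s))) + (F (x ∘ s ∘ t) - F (x ∘ s ∘ t ∘ s)))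
  left x = expand-∂∂∂ (δ i j x) (δ j k x) (δ i k x) 
    {B = B x} {B (x ∘ s)} {A x} {A (x ∘ t)} {A (x ∘ s)} {A (x ∘ s ∘ t)}
    {F x} {F (x ∘ s)} {F (x ∘ t)} {F (x ∘ t ∘ s)} {F (x ∘ s ∘ t)} {F (x ∘ s ∘ t ∘ s)} (δ-sum x)
    (eq dC x) (eq dB x) (at dB (x ∘ s) x i k (cong x sj) (cong x sk))
    (eq dA x) (at dA (x ∘ t) x i k (cong x ti) (cong x tj)) (negated dA x)
    (at dA (x ∘ s ∘ t) x j k (trans (cong (x ∘ s) ti) (cong x si)) (trans (cong (x ∘ s) tj) (cong x sk)))
  right : ∀ x → δ j k x * (δ j k x * (δ i j x * (δ i k x * C′ x))) ≡
    δ j k x * (((F x - F (x ∘ t)) - (F (x ∘ s) - F (x ∘ s ∘ t))) + (F (x ∘ t ∘ s) - F (x ∘ t ∘ s ∘ t)))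
  right x = expand-∂∂∂ (δ j k x) (δ i j x) (δ i k x)
    {B = B′ x} {B′ (x ∘ t)} {A′ x} {A′ (x ∘ s)} {A′ (x ∘ t)} {A′ (x ∘ t ∘ s)}
    {F x} {F (x ∘ t)} {F (x ∘ s)} {F (x ∘ s ∘ t)} {F (x ∘ t ∘ s)} {F (x ∘ t ∘ s ∘ t)}
    (trans (δ-sum x) (ℤₚ.+-comm (δ i j x) (δ j k x)))
    (eq dC′ x) (eq dB′ x) (at dB′ (x ∘ t) x i k (cong x ti) (cong x tj))
    (eq dA′ x) (at dA′ (x ∘ s) x i k (cong x sj) (cong x sk)) (negated dA′ x)
    (at dA′ (x ∘ t ∘ s) x i j (trans (cong (x ∘ t) sj) (cong x ti)) (trans (cong (x ∘ t) sk) (cong x tk)))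
  combine : ∀ a b c {C C′ f fs ft fts fst f₃ f₃′} → f₃ ≡ f₃′ →
    a * (a * (b * (c * C))) ≡ a * (((f - fs) - (ft - fts)) + (fst - f₃)) →
    b * (b * (a * (c * C′))) ≡ b * (((f - ft) - (fs - fst)) + (fts - f₃′)) →
    a * (a * (b * (b * (c * C)))) ≡ a * (a * (b * (b * (c * C′))))
  combine a b c {C} {C′} {f} {fs} {ft} {fts} {fst} {f₃} refl h h′ =
    trans (e₁ a b (c * C)) (trans (cong (b *_) h)
      (trans (e₂ a b f fs ft fts fst f₃) (trans (cong (a *_) (sym h′)) (e₃ a b (c * C′)))))
    where
    e₁ : ∀ a b C → a * (a * (b * (b * C))) ≡ b * (a * (a * (b * C)))
    e₁ = solve-∀
    e₂ : ∀ a b f fs ft fts fst f₃ → b * (a * (((f - fs) - (ft - fts)) + (fst - f₃))) ≡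
         a * (b * (((f - ft) - (fs - fst)) + (fts - f₃)))
    e₂ = solve-∀
    e₃ : ∀ a b C → a * (b * (b * (a * C))) ≡ a * (a * (b * (b * C)))
    e₃ = solve-∀
  step : ∀ x → δ i j x * (δ i j x * (δ j k x * (δ j k x * (δ i k x * C x)))) ≡
               δ i j x * (δ i j x * (δ j k x * (δ j k x * (δ i k x * C′ x))))
  step x = combine (δ i j x) (δ j k x) (δ i k x)
    {f = F x} {F (x ∘ s)} {F (x ∘ t)} {F (x ∘ t ∘ s)} {F (x ∘ s ∘ t)}
    -- The two expansions contain the same values of `F`, except that the last one is taken at
    -- `x ∘ s ∘ t ∘ s` or at `x ∘ t ∘ s ∘ t`; these points agree by the braid relation.
    (cp-ext (cpᶠ dA) (λ m → cong x (swap-braid i≢j j≢k i≢k m))) (left x) (right x)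

-- Evaluation of formal polynomials

monomial : ∀ {n} → Mono n → Fun n
monomial a x = prodℤ (λ k → x k ^ a k)

eval : ∀ {n} → Poly n → Fun n
eval [] x = 0ℤ
eval ((c , a) ∷ f) x = c * monomial a x + eval f x

eval-++ : ∀ {n} (f g : Poly n) x → eval (f ++ g) x ≡ eval f x + eval g x
eval-++ [] g x = sym (ℤₚ.+-identityˡ _)
eval-++ ((c , a) ∷ f) g x = trans (cong (λ u → c * monomial a x + u) (eval-++ f g x))
  (sym (ℤₚ.+-assoc (c * monomial a x) _ _))

cp-eval : ∀ {n} (f : Poly n) → CongruencePreserving (eval f)
cp-eval [] = cp-const 0ℤ
cp-eval ((c , a) ∷ f) =
  cp-+ (cp-* (cp-const c) (cp-prod (λ k → cp-^ (cp-var k) (a k)))) (cp-eval f)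

setExp-left : ∀ {n} (i j : Fin n) p q a → setExp i p j q a i ≡ p
setExp-left i j p q a with i Finₚ.≟ i
... | yes _ = refl
... | no i≢i = contradiction refl i≢i

setExp-right : ∀ {n} {i j : Fin n} → i ≢ j → ∀ p q a → setExp i p j q a j ≡ q
setExp-right {i = i} {j} i≢j p q a with j Finₚ.≟ i
... | yes j≡i = contradiction (sym j≡i) i≢j
... | no _ with j Finₚ.≟ j
...   | yes _ = refl
...   | no j≢j = contradiction refl j≢j

setExp-other : ∀ {n} {i j k : Fin n} p q a → k ≢ i → k ≢ j → setExp i p j q a k ≡ a k
setExp-other {i = i} {j} {k} p q a k≢i k≢j with k Finₚ.≟ i
... | yes k≡i = contradiction k≡i k≢i
... | no _ with k Finₚ.≟ j
...   | yes k≡j = contradiction k≡j k≢j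
...   | no _ = refl

-- The reindexing `h` is kept general because the tail of `applyUpTo h` is enumerated by `h ∘ suc`.
telescope : ∀ {n} (z : ℤ) (x : Fin n → ℤ) (g : ℕ → ℤ × Mono n) (h : ℕ → ℕ) (T : ℕ → ℤ) m →
            (∀ {k} → k ℕ.< m → z * eval (g (h k) ∷ []) x ≡ T k - T (suc k)) →
            z * eval (List.map g (applyUpTo h m)) x ≡ T 0 - T m
telescope z x g h T zero step = trans (ℤₚ.*-zeroʳ z) (sym (ℤₚ.+-inverseʳ (T 0)))
telescope z x g h T (suc m) step = trans (split z (proj₁ (g (h 0)) * monomial (proj₂ (g (h 0))) x) _)
  (trans (cong₂ _+_ (step (s≤s z≤n)) (telescope z x g (h ∘ suc) (T ∘ suc) m (step ∘ s≤s)))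
         (collapse (T 0) (T 1) (T (suc m))))
  where
  split : ∀ z a b → z * (a + b) ≡ z * (a + 0ℤ) + z * b
  split = solve-∀
  collapse : ∀ a b c → (a - b) + (b - c) ≡ a - c
  collapse = solve-∀

module _ {n} {i j : Fin n} (i≢j : i ≢ j) (a : Mono n) (x : Fin n → ℤ) where

  rest : ℤ
  rest = monomial (setExp i 0 j 0 a) x

  split-off : (f : Fin n → ℤ) → (∀ k → k ≢ i → k ≢ j → f k ≡ x k ^ a k) →
              prodℤ f ≡ f i * (f j * rest)
  split-off f f≡ = prodℤ-two i≢j
    (λ k k≢i k≢j → trans (f≡ k k≢i k≢j) (cong (x k ^_) (sym (setExp-other 0 0 a k≢i k≢j))))
    (cong (x i ^_) (setExp-left i j 0 0 a)) (cong (x j ^_) (setExp-right i≢j 0 0 a))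

  monomial-split : monomial a x ≡ x i ^ a i * (x j ^ a j * rest)
  monomial-split = split-off (λ k → x k ^ a k) (λ _ _ _ → refl)

  monomial-setExp : ∀ p q → monomial (setExp i p j q a) x ≡ x i ^ p * (x j ^ q * rest)
  monomial-setExp p q = trans
    (split-off (λ k → x k ^ setExp i p j q a k) (λ k k≢i k≢j → cong (x k ^_) (setExp-other p q a k≢i k≢j)))
    (cong₂ (λ u v → x i ^ u * (x j ^ v * rest)) (setExp-left i j p q a) (setExp-right i≢j p q a))

  monomial-swap : monomial a (x ∘ swapFin i j) ≡ x j ^ a i * (x i ^ a j * rest)
  monomial-swap = trans
    (split-off (λ k → x (swapFin i j k) ^ a k)
      (λ k k≢i k≢j → cong (λ l → x l ^ a k) (swap-other k≢i k≢j)))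
    (cong₂ (λ u v → x u ^ a i * (x v ^ a j * rest)) (swap-left i j) (swap-right i j))

  -- With X = `x i` and Y = `x j`, this is (X - Y) Σ X^(d-k) Y^k = X^(d+1) - Y^(d+1), multiplied by
  -- `c`, (XY)^q and `rest`. The terms `T k` of the telescoping sum trade one power of X for one of
  -- Y.
  ∂-geometric : ∀ c q d →
    δ i j x * eval (List.map (λ k → (c , setExp i (q ℕ.+ d ℕ.∸ k) j (q ℕ.+ k) a)) (upTo (suc d))) x ≡
    c * (x i ^ suc (q ℕ.+ d) * (x j ^ q * rest)) - c * (x i ^ q * (x j ^ suc (q ℕ.+ d) * rest))
  ∂-geometric c q d = trans
    (telescope (δ i j x) x (λ k → (c , setExp i (q ℕ.+ d ℕ.∸ k) j (q ℕ.+ k) a)) id T (suc d) step)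
    (cong₂ _-_ (cong (λ e → c * (x i ^ suc (q ℕ.+ d) * (x j ^ e * rest))) (ℕₚ.+-identityʳ q))
      (cong₂ (λ u v → c * (x i ^ u * (x j ^ v * rest))) (ℕₚ.m+n∸n≡m q d) (ℕₚ.+-suc q d)))
    where
    T : ℕ → ℤ
    T k = c * (x i ^ (suc (q ℕ.+ d) ℕ.∸ k) * (x j ^ (q ℕ.+ k) * rest))
    rearrange : ∀ X Y c p q r → (X - Y) * (c * (p * (q * r)) + 0ℤ) ≡
                c * (X * p * (q * r)) - c * (p * (Y * q * r))
    rearrange = solve-∀
    step : ∀ {k} → k ℕ.< suc d →
      δ i j x * eval ((c , setExp i (q ℕ.+ d ℕ.∸ k) j (q ℕ.+ k) a) ∷ []) x ≡ T k - T (suc k)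
    step {k} (s≤s k≤d) = trans
      (cong (λ m → δ i j x * (c * m + 0ℤ)) (monomial-setExp (q ℕ.+ d ℕ.∸ k) (q ℕ.+ k)))
      (trans (rearrange (x i) (x j) c (x i ^ (q ℕ.+ d ℕ.∸ k)) (x j ^ (q ℕ.+ k)) rest)
        (cong₂ (λ u v → c * (x i ^ u * (x j ^ (q ℕ.+ k) * rest)) -
                        c * (x i ^ (q ℕ.+ d ℕ.∸ k) * (x j ^ v * rest)))
          (sym (ℕₚ.+-∸-assoc 1 (ℕₚ.≤-trans k≤d (ℕₚ.m≤n+m d q)))) (sym (ℕₚ.+-suc q k))))

  -- The exponents `a i` and `a j` stay visible on the right, so that comparing them specialises
  -- both sides. The case `less` is the geometric sum for `- c`, with the two resulting products in
  -- exchanged roles.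
  ∂term-split : ∀ c → δ i j x * eval (∂term i j (c , a)) x ≡
    c * (x i ^ a i * (x j ^ a j * rest)) - c * (x j ^ a i * (x i ^ a j * rest))
  ∂term-split c with a i | a j | ℕ.compare (a i) (a j)
  ... | p | .(suc (p ℕ.+ d)) | ℕ.less .p d =
    trans (∂-geometric (- c) p d)
      (rearrange c (x i ^ suc (p ℕ.+ d)) (x i ^ p) (x j ^ p) (x j ^ suc (p ℕ.+ d)) rest)
    where
    rearrange : ∀ c X Y y Z r → - c * (X * (y * r)) - - c * (Y * (Z * r)) ≡
                c * (Y * (Z * r)) - c * (y * (X * r))
    rearrange = solve-∀
  ... | p | .p | ℕ.equal .p = trans (ℤₚ.*-zeroʳ (δ i j x)) (rearrange c (x i ^ p) (x j ^ p) rest)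
    where
    rearrange : ∀ c X Y r → 0ℤ ≡ c * (X * (Y * r)) - c * (Y * (X * r))
    rearrange = solve-∀
  ... | .(suc (q ℕ.+ d)) | q | ℕ.greater .q d =
    trans (∂-geometric c q d)
      (rearrange c (x i ^ suc (q ℕ.+ d)) (x i ^ q) (x j ^ q) (x j ^ suc (q ℕ.+ d)) rest)
    where
    rearrange : ∀ c X Y y Z r → c * (X * (y * r)) - c * (Y * (Z * r)) ≡
                c * (X * (y * r)) - c * (Z * (Y * r))
    rearrange = solve-∀

∂-isD : ∀ {n} {i j : Fin n} → i ≢ j → (f : Poly n) → IsD i j (eval f) (eval (∂ i j f))
∂-isD {n} {i} {j} i≢j f = record { cpᶠ = cp-eval f ; cpᵍ = cp-eval (∂ i j f) ; eq = go f }
  where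
  go : ∀ f x → δ i j x * eval (∂ i j f) x ≡ eval f x - eval f (x ∘ swapFin i j)
  go [] x = ℤₚ.*-zeroʳ (δ i j x)
  go ((c , a) ∷ f) x = trans (cong (δ i j x *_) (eval-++ (∂term i j (c , a)) (∂ i j f) x))
    (difference-+ (δ i j x) _ _
      (c * monomial a x) (c * monomial a (x ∘ swapFin i j)) (eval f x) (eval f (x ∘ swapFin i j))
      (trans (∂term-split i≢j a x c)
        (cong₂ (λ u v → c * u - c * v) (sym (monomial-split i≢j a x)) (sym (monomial-swap i≢j a x))))
      (go f x))

eval-ones : ∀ {n} (f : Poly n) → eval f (const 1ℤ) ≡ evalOnes f
eval-ones [] = refl
eval-ones ((c , a) ∷ f) = cong₂ _+_ (trans (cong (c *_) (ones a)) (ℤₚ.*-identityʳ c)) (eval-ones f)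
  where
  ones : ∀ {n} (a : Mono n) → monomial a (const 1ℤ) ≡ 1ℤ
  ones {zero} a = refl
  ones {suc n} a = cong₂ _*_ (ℤₚ.^-zeroˡ (a zero)) (ones (a ∘ suc))

-- The exponent of `x i` in the staircase exceeds that of `x j` by one. The factor `x j` evens them
-- out and makes the product symmetric in the two variables.
staircase-invariant : ∀ {n} {i j : Fin n} → toℕ j ≡ suc (toℕ i) → ∀ x →
  x (swapFin i j j) * eval (staircase n) (x ∘ swapFin i j) ≡ x j * eval (staircase n) x
staircase-invariant {n} {i} {j} j≡1+i x = trans
  (cong₂ (λ k m → x k * (1ℤ * m + 0ℤ)) (swap-right i j) (monomial-swap i≢j a x))
  (trans (cong (λ e → x i * (1ℤ * (x j ^ e * (x i ^ a j * rest i≢j a x)) + 0ℤ)) ai≡)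
  (trans (rearrange (x i) (x j) (x i ^ a j) (x j ^ a j) (rest i≢j a x))
  (trans (cong (λ e → x j * (1ℤ * (x i ^ e * (x j ^ a j * rest i≢j a x)) + 0ℤ)) (sym ai≡))
    (cong (λ m → x j * (1ℤ * m + 0ℤ)) (sym (monomial-split i≢j a x))))))
  where
  i≢j : i ≢ j
  i≢j refl = ℕₚ.1+n≢n (sym j≡1+i)
  a : Mono n
  a k = n ℕ.∸ suc (toℕ k)
  ai≡ : a i ≡ suc (a j)
  -- The truncated subtraction loses nothing here, because `j` is still below `n`.
  ai≡ = trans (ℕₚ.+-∸-assoc 1 (subst (ℕ._≤ n) (cong suc j≡1+i) (Finₚ.toℕ<n j)))
              (cong (λ m → suc (n ℕ.∸ suc m)) (sym j≡1+i))
  rearrange : ∀ X Y P Q r → X * (1ℤ * (Y * Q * (P * r)) + 0ℤ) ≡ Y * (1ℤ * (X * P * (Q * r)) + 0ℤ)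
  rearrange = solve-∀

-- Independence of the chosen ascents

Adjacent : ∀ {n} → Fin n → Fin n → Set
Adjacent i j = toℕ j ≡ suc (toℕ i)

adjacent⇒< : ∀ {n} {i j : Fin n} → Adjacent i j → i Fin.< j
adjacent⇒< adj = ℕₚ.≤-reflexive (sym adj)

adjacent⇒≢ : ∀ {n} {i j : Fin n} → Adjacent i j → i ≢ j
adjacent⇒≢ adj refl = ℕₚ.1+n≢n (sym adj)

-- Indicators, finite sums and non-inversions

ind : ∀ {P : Set} → Dec P → ℕ
ind d = if does d then 1 else 0

ind-yes : ∀ {P : Set} (d : Dec P) → P → ind d ≡ 1
ind-yes (yes _) p = refl
ind-yes (no ¬p) p = contradiction p ¬p

ind-no : ∀ {P : Set} (d : Dec P) → ¬ P → ind d ≡ 0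
ind-no (yes p) ¬p = contradiction p ¬p
ind-no (no _) ¬p = refl

ind-≤ : ∀ {P : Set} (d : Dec P) {m} → (P → 1 ℕ.≤ m) → ind d ℕ.≤ m
ind-≤ (yes p) h = h p
ind-≤ (no _) h = z≤n

sumℕ-mono-≤ : ∀ {n} {f g : Fin n → ℕ} → (∀ k → f k ℕ.≤ g k) → sumℕ f ℕ.≤ sumℕ g
sumℕ-mono-≤ {zero} f≤g = z≤n
sumℕ-mono-≤ {suc n} f≤g = ℕₚ.+-mono-≤ (f≤g zero) (sumℕ-mono-≤ (f≤g ∘ suc))

sumℕ-mono-< : ∀ {n} {f g : Fin n → ℕ} → (∀ k → f k ℕ.≤ g k) → ∀ k → f k ℕ.< g k → sumℕ f ℕ.< sumℕ g
sumℕ-mono-< f≤g zero fk<gk = ℕₚ.+-mono-<-≤ fk<gk (sumℕ-mono-≤ (f≤g ∘ suc))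
sumℕ-mono-< f≤g (suc k) fk<gk = ℕₚ.+-mono-≤-< (f≤g zero) (sumℕ-mono-< (f≤g ∘ suc) k fk<gk)

sumℕ-bounded : ∀ {n} {f : Fin n → ℕ} {b} → (∀ k → f k ℕ.≤ b) → sumℕ f ℕ.≤ n ℕ.* b
sumℕ-bounded {zero} f≤b = z≤n
sumℕ-bounded {suc n} f≤b = ℕₚ.+-mono-≤ (f≤b zero) (sumℕ-bounded (f≤b ∘ suc))

swapPerm : ∀ {n} → Fin n → Fin n → Permutation′ n
swapPerm i j = permutation (swapFin i j) (swapFin i j) (swap-involutive i j) (swap-involutive i j)

-- For a permutation this is the difference of the lengths of w₀ and `w`: the measure of the
-- inductions towards w₀ and a bound for the fuel. The condition on positions sits inside the
-- indicator so that both sums can be reindexed by a transposition.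
non-inversions : ∀ {n} → (Fin n → Fin n) → ℕ
non-inversions w = sumℕ λ p → sumℕ λ q → ind (p Fin.<? q ×-dec w p Fin.<? w q)

non-inversions-bounded : ∀ {n} (w : Fin n → Fin n) → non-inversions w ℕ.≤ n ℕ.* n
non-inversions-bounded {n} w = sumℕ-bounded λ p → ℕₚ.≤-trans
  (sumℕ-bounded λ q → ind-≤ (p Fin.<? q ×-dec w p Fin.<? w q) λ _ → ℕₚ.≤-refl)
  (ℕₚ.≤-reflexive (ℕₚ.*-identityʳ n))

-- No index lies strictly between `i` and `j`, so every other index is on the same side of both.
swap-reverses : ∀ {n} {i j : Fin n} → Adjacent i j → ∀ q p → q Fin.< p →
                swapFin i j p Fin.< swapFin i j q → q ≡ i × p ≡ j
swap-reverses {n} {i} {j} adj = swap-elim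
  (λ q → ∀ p → q Fin.< p → swapFin i j p Fin.< swapFin i j q → q ≡ i × p ≡ j)
  (swap-elim (λ p → i Fin.< p → swapFin i j p Fin.< swapFin i j i → i ≡ i × p ≡ j)
    (λ i<i _ → ⊥-elim (ℕₚ.<-irrefl refl i<i))
    (λ _ _ → refl , refl)
    (λ {k} k≢i k≢j i<k sk<si → ⊥-elim (ℕₚ.<⇒≱ (subst₂ Fin._<_ (swap-other k≢i k≢j) (swap-left i j) sk<si)
      (subst (ℕ._≤ toℕ k) (sym adj) i<k))))
  (swap-elim (λ p → j Fin.< p → swapFin i j p Fin.< swapFin i j j → j ≡ i × p ≡ j)
    (λ j<i _ → ⊥-elim (ℕₚ.<-asym j<i (adjacent⇒< adj)))
    (λ j<j _ → ⊥-elim (ℕₚ.<-irrefl refl j<j))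
    (λ {k} k≢i k≢j j<k sk<sj → ⊥-elim (ℕₚ.<-asym (subst₂ Fin._<_ (swap-other k≢i k≢j) (swap-right i j) sk<sj)
      (ℕₚ.<-trans (adjacent⇒< adj) j<k))))
  (λ {q} q≢i q≢j → swap-elim (λ p → q Fin.< p → swapFin i j p Fin.< swapFin i j q → q ≡ i × p ≡ j)
    (λ q<i si<sq → ⊥-elim (ℕₚ.<-asym (ℕₚ.<-trans q<i (adjacent⇒< adj))
      (subst₂ Fin._<_ (swap-left i j) (swap-other q≢i q≢j) si<sq)))
    (λ q<j sj<sq → ⊥-elim (ℕₚ.<⇒≱ q<j (subst (ℕ._≤ toℕ q) (sym adj)
      (subst₂ Fin._<_ (swap-right i j) (swap-other q≢i q≢j) sj<sq))))
    (λ p≢i p≢j q<p sp<sq → ⊥-elim (ℕₚ.<-asym q<p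
      (subst₂ Fin._<_ (swap-other p≢i p≢j) (swap-other q≢i q≢j) sp<sq))))

-- After both sums are reindexed by the transposition, the indicators for `w ∘ swapFin i j` lie
-- below those for `w` term by term, and the term at the pair `i`, `j` drops from 1 to 0.
non-inversions-decrease : ∀ {n} (w : Fin n → Fin n) {i j} → Adjacent i j → w i Fin.< w j →
                          non-inversions (w ∘ swapFin i j) ℕ.< non-inversions w
non-inversions-decrease {n} w {i} {j} adj wi<wj = subst (ℕ._< non-inversions w) (sym reindexed)
  (sumℕ-mono-< (λ p → sumℕ-mono-≤ (pointwise p)) i (sumℕ-mono-< (pointwise i) j strict))
  where
  s = swapFin i j
  f : Fin n → Fin n → ℕ
  f p q = ind (p Fin.<? q ×-dec w (s p) Fin.<? w (s q))
  reindexed : non-inversions (w ∘ s) ≡ sumℕ λ p → sumℕ λ q → f (s p) (s q)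
  reindexed = trans (sumℕ-permute (λ p → sumℕ (f p)) (swapPerm i j))
                    (sumℕ-cong λ p → sumℕ-permute (f (s p)) (swapPerm i j))
  pointwise : ∀ p q → f (s p) (s q) ℕ.≤ ind (p Fin.<? q ×-dec w p Fin.<? w q)
  pointwise p q = ind-≤ (s p Fin.<? s q ×-dec w (s (s p)) Fin.<? w (s (s q))) λ (sp<sq , w<w) →
    let wp<wq = subst₂ (λ a b → w a Fin.< w b) (swap-involutive i j p) (swap-involutive i j q) w<w
    in ℕₚ.≤-reflexive (sym (ind-yes (p Fin.<? q ×-dec w p Fin.<? w q) (order sp<sq wp<wq , wp<wq)))
    where
    order : s p Fin.< s q → w p Fin.< w q → p Fin.< q
    order sp<sq wp<wq with p Fin.<? q
    ... | yes p<q = p<q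
    ... | no p≮q with p Finₚ.≟ q
    ...   | yes refl = contradiction sp<sq (ℕₚ.<-irrefl refl)
    ...   | no p≢q with swap-reverses adj q p (ℕₚ.≤∧≢⇒< (ℕₚ.≮⇒≥ p≮q) (p≢q ∘ sym ∘ Finₚ.toℕ-injective)) sp<sq
    ...     | refl , refl = contradiction wp<wq (ℕₚ.<-asym wi<wj)
  strict : f (s i) (s j) ℕ.< ind (i Fin.<? j ×-dec w i Fin.<? w j)
  strict = subst₂ ℕ._<_
    (sym (ind-no (s i Fin.<? s j ×-dec w (s (s i)) Fin.<? w (s (s j)))
      λ (si<sj , _) → ℕₚ.<-asym (adjacent⇒< adj) (subst₂ Fin._<_ (swap-left i j) (swap-right i j) si<sj)))
    (sym (ind-yes (i Fin.<? j ×-dec w i Fin.<? w j) (adjacent⇒< adj , wi<wj))) (s≤s z≤n)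

-- The search for the first ascent and the fuel

pairs : ∀ n → List (Fin n × Fin n)
pairs n = concatMap (λ i → List.map (λ j → (i , j)) (allFin n)) (allFin n)

∈-pairs : ∀ {n} (i j : Fin n) → (i , j) ∈ pairs n
∈-pairs {n} i j = ∈-concatMap⁺ (λ i → List.map (λ j → (i , j)) (allFin n))
  (Any.map (λ { refl → ∈-map⁺ (λ j → (i , j)) (∈-allFin j) }) (∈-allFin i))

data SearchResult {n} (w : Fin n → Fin n) (l : List (Fin n × Fin n)) : Maybe (Fin n × Fin n) → Set where
  found : ∀ {i j} → Adjacent i j → w i Fin.< w j → SearchResult w l (just (i , j))
  none  : (∀ {i j} → (i , j) ∈ l → Adjacent i j → ¬ w i Fin.< w j) → SearchResult w l nothing

extend : ∀ {n} {w : Fin n → Fin n} {l r i j} → (Adjacent i j → ¬ w i Fin.< w j) →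
         SearchResult w l r → SearchResult w ((i , j) ∷ l) r
extend ¬asc (found adj w<w) = found adj w<w
extend ¬asc (none h) = none λ { (here refl) → ¬asc ; (there p) → h p }

-- The search loop of firstAscent is a local function without a name; the underscores in the
-- auxiliary signatures stand for it and are solved once the list of pairs is abstracted.
mutual
  firstAscent-result : ∀ {n} (w : Fin n → Fin n) → SearchResult w (pairs n) (firstAscent w)
  firstAscent-result {n} w with pairs n
  ... | l = search-result n w l

  search-result : ∀ n (w : Fin n → Fin n) l → SearchResult w l _
  search-result n w [] = none λ ()
  search-result n w ((i , j) ∷ rest) with toℕ j ℕ.≟ suc (toℕ i) | w i Fin.<? w j
  ... | yes adj | yes wi<wj = found adj wi<wj
  ... | yes _ | no wi≮wj = extend (λ _ → wi≮wj) (search-result n w rest)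
  ... | no ¬adj | _ = extend (λ adj → contradiction adj ¬adj) (search-result n w rest)

mutual
  firstAscent-cong : ∀ {n} {w w′ : Fin n → Fin n} → w ≗ w′ → firstAscent w ≡ firstAscent w′
  firstAscent-cong {n} {w} {w′} w≗w′ with pairs n
  ... | l = search-cong n w w′ w≗w′ l

  search-cong : ∀ n (w w′ : Fin n → Fin n) → w ≗ w′ → ∀ l → _ ≡ _
  search-cong n w w′ w≗w′ [] = refl
  search-cong n w w′ w≗w′ ((i , j) ∷ rest)
    with toℕ j ℕ.≟ suc (toℕ i) | w i Fin.<? w j | w′ i Fin.<? w′ j
  ... | yes _ | yes _ | yes _ = refl
  ... | yes _ | yes lt | no ≮ = contradiction (subst₂ Fin._<_ (w≗w′ i) (w≗w′ j) lt) ≮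
  ... | yes _ | no ≮ | yes lt = contradiction (subst₂ Fin._<_ (sym (w≗w′ i)) (sym (w≗w′ j)) lt) ≮
  ... | yes _ | no _ | no _ = search-cong n w w′ w≗w′ rest
  ... | no _ | _ | _ = search-cong n w w′ w≗w′ rest

schubertAux-cong : ∀ {n} fuel {w w′ : Fin n → Fin n} → w ≗ w′ → schubertAux fuel w ≡ schubertAux fuel w′
schubertAux-cong zero w≗w′ = refl
schubertAux-cong (suc fuel) {w} {w′} w≗w′
  with firstAscent w | firstAscent w′ | firstAscent-cong w≗w′
... | nothing | _ | refl = refl
... | just (i , j) | _ | refl = cong (∂ i j) (schubertAux-cong fuel (w≗w′ ∘ swapFin i j))

-- A step consumes one unit of fuel and at least one non-inversion. Fuel that starts above the count
-- can therefore run out only when no ascent is left, and then both branches return the staircase.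
schubertAux-fuel : ∀ {n} f g {w : Fin n → Fin n} → non-inversions w ℕ.≤ f → non-inversions w ℕ.≤ g →
                   schubertAux f w ≡ schubertAux g w
schubertAux-fuel zero zero _ _ = refl
schubertAux-fuel zero (suc g) {w} w≤f w≤g with firstAscent w | firstAscent-result w
... | nothing | _ = refl
... | just _ | found adj w<w =
  contradiction (ℕₚ.≤-trans (non-inversions-decrease w adj w<w) w≤f) λ ()
schubertAux-fuel (suc f) zero {w} w≤f w≤g with firstAscent w | firstAscent-result w
... | nothing | _ = refl
... | just _ | found adj w<w =
  contradiction (ℕₚ.≤-trans (non-inversions-decrease w adj w<w) w≤g) λ ()
schubertAux-fuel (suc f) (suc g) {w} w≤f w≤g with firstAscent w | firstAscent-result w
... | nothing | _ = refl
... | just (i , j) | found adj w<w = cong (∂ i j) (schubertAux-fuel f g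
  (ℕₚ.≤-pred (ℕₚ.≤-trans (non-inversions-decrease w adj w<w) w≤f))
  (ℕₚ.≤-pred (ℕₚ.≤-trans (non-inversions-decrease w adj w<w) w≤g)))

𝔖 : ∀ {n} → (Fin n → Fin n) → Poly n
𝔖 {n} = schubertAux (n ℕ.* n)

-- The recursion for `𝔖` freed from the fuel: both sides of the equation in `step` use the full
-- amount.
data FirstStep {n} (w : Fin n → Fin n) : Set where
  step : ∀ {i j} → Adjacent i j → w i Fin.< w j → 𝔖 w ≡ ∂ i j (𝔖 (w ∘ swapFin i j)) → FirstStep w
  stop : (∀ {i j} → Adjacent i j → ¬ w i Fin.< w j) → 𝔖 w ≡ staircase n → FirstStep w

firstStep : ∀ {n} (w : Fin n → Fin n) → FirstStep w
firstStep {zero} w = stop (λ { {()} }) refl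
firstStep {suc m} w with firstAscent w in fa | firstAscent-result w
... | nothing | none h = stop (λ {i} {j} → h (∈-pairs i j)) (𝔖-stop fa)
  where
  𝔖-stop : firstAscent w ≡ nothing → 𝔖 w ≡ staircase (suc m)
  𝔖-stop e rewrite e = refl
... | just (i , j) | found adj w<w = step adj w<w (trans (𝔖-step fa) (cong (∂ i j)
    -- The fuel left after one step is the predecessor of `suc m * suc m`; it still bounds the
    -- non-inversions of the next permutation, since these have decreased.
    (schubertAux-fuel (m ℕ.+ m ℕ.* suc m) _
      (ℕₚ.≤-pred (ℕₚ.≤-trans (non-inversions-decrease w adj w<w) (non-inversions-bounded w)))
      (non-inversions-bounded (w ∘ swapFin i j)))))
  where
  𝔖-step : firstAscent w ≡ just (i , j) →
           𝔖 w ≡ ∂ i j (schubertAux (m ℕ.+ m ℕ.* suc m) (w ∘ swapFin i j))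
  𝔖-step e rewrite e = refl

E : ∀ {n} → (Fin n → Fin n) → Fun n
E w = eval (𝔖 w)

E-cong : ∀ {n} {w w′ : Fin n → Fin n} → w ≗ w′ → ∀ x → E w x ≡ E w′ x
E-cong {n} w≗w′ x = cong (λ f → eval f x) (schubertAux-cong (n ℕ.* n) w≗w′)

cp-E : ∀ {n} (w : Fin n → Fin n) → CongruencePreserving (E w)
cp-E w = cp-eval (𝔖 w)

-- Divided differences at arbitrary ascents

adjacent-unique : ∀ {n} {i j k : Fin n} → Adjacent i j → Adjacent i k → j ≡ k
adjacent-unique ij ik = Finₚ.toℕ-injective (trans ij (sym ik))

adjacent-uniqueˡ : ∀ {n} {i j k : Fin n} → Adjacent i k → Adjacent j k → i ≡ j
adjacent-uniqueˡ ik jk = Finₚ.toℕ-injective (ℕₚ.suc-injective (trans (sym ik) jk))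

AscentsDifferentiate : ∀ {n} → (Fin n → Fin n) → Set
AscentsDifferentiate w = ∀ {i j} → Adjacent i j → w i Fin.< w j → IsD i j (E (w ∘ swapFin i j)) (E w)

module _ {n} (w : Fin n → Fin n)
         (ih : ∀ (v : Fin n → Fin n) → non-inversions v ℕ.< non-inversions w → AscentsDifferentiate v) where

  -- `G` and `H` are two candidates for the Schubert polynomial of `w`. By the induction hypothesis
  -- both arise by two divided differences, in opposite orders, from the permutation with both
  -- ascents removed.
  commuting-ascents : ∀ {i j k l} → Adjacent i j → Adjacent k l → k ≢ i → k ≢ j → l ≢ i → l ≢ j →
    w i Fin.< w j → w k Fin.< w l → ∀ {G H} →
    IsD i j (E (w ∘ swapFin i j)) G → IsD k l (E (w ∘ swapFin k l)) H → G ≗ H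
  commuting-ascents {i} {j} {k} {l} ij kl k≢i k≢j l≢i l≢j wi<wj wk<wl dG dH =
    isD-commute (adjacent⇒≢ kl) (adjacent⇒≢ ij) (k≢i ∘ sym) (l≢i ∘ sym) (k≢j ∘ sym) (l≢j ∘ sym)
      d₁ dG (isD-resp (cpᶠ d₁) (cpᵍ d₂) same (λ _ → refl) d₂) dH
    where
    d₁ = ih (w ∘ swapFin i j) (non-inversions-decrease w ij wi<wj) kl
      (subst₂ (λ a b → w a Fin.< w b) (sym (swap-other k≢i k≢j)) (sym (swap-other l≢i l≢j)) wk<wl)
    d₂ = ih (w ∘ swapFin k l) (non-inversions-decrease w kl wk<wl) ij
      (subst₂ (λ a b → w a Fin.< w b) (sym (swap-other (k≢i ∘ sym) (l≢i ∘ sym)))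
        (sym (swap-other (k≢j ∘ sym) (l≢j ∘ sym))) wi<wj)
    same = E-cong (λ m → cong w (sym (swap-commute k≢i k≢j l≢i l≢j m)))

  -- The entries at `i`, `j`, `k` increase. Both candidates arise by three divided differences from
  -- the permutation in which these entries are reversed, along the two reduced words of the
  -- reversal.
  adjacent-ascents : ∀ {i j k} → Adjacent i j → Adjacent j k → w i Fin.< w j → w j Fin.< w k →
    ∀ {G H} → IsD i j (E (w ∘ swapFin i j)) G → IsD j k (E (w ∘ swapFin j k)) H → G ≗ H
  adjacent-ascents {i} {j} {k} ij jk wi<wj wj<wk dG dH =
    isD-braid i≢j j≢k i≢k d₁ d₂ dG (isD-resp (cpᶠ d₁) (cpᵍ d₁′) same (λ _ → refl) d₁′) d₂′ dH
    where
    i≢j = adjacent⇒≢ ij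
    j≢k = adjacent⇒≢ jk
    i≢k : i ≢ k
    i≢k refl = ℕₚ.<-asym (adjacent⇒< ij) (adjacent⇒< jk)
    s = swapFin i j
    t = swapFin j k
    si = swap-left i j
    sj = swap-right i j
    sk : s k ≡ k
    sk = swap-other (i≢k ∘ sym) (j≢k ∘ sym)
    ti : t i ≡ i
    ti = swap-other i≢j i≢k
    tj = swap-left j k
    tk = swap-right j k
    wi<wk = ℕₚ.<-trans wi<wj wj<wk
    lt-at : ∀ {a b c d} → a ≡ c → b ≡ d → w c Fin.< w d → w a Fin.< w b
    lt-at refl refl lt = lt
    n₂ = non-inversions-decrease w ij wi<wj
    a₂ : w (s j) Fin.< w (s k)
    a₂ = lt-at sj sk wi<wk
    d₂ = ih (w ∘ s) n₂ jk a₂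
    d₁ = ih (w ∘ s ∘ t) (ℕₚ.<-trans (non-inversions-decrease (w ∘ s) jk a₂) n₂) ij
      (lt-at (trans (cong s ti) si) (trans (cong s tj) sk) wj<wk)
    n₂′ = non-inversions-decrease w jk wj<wk
    a₂′ : w (t i) Fin.< w (t j)
    a₂′ = lt-at ti tj wi<wk
    d₂′ = ih (w ∘ t) n₂′ ij a₂′
    d₁′ = ih (w ∘ t ∘ s) (ℕₚ.<-trans (non-inversions-decrease (w ∘ t) ij a₂′) n₂′) jk
      (lt-at (trans (cong t sj) ti) (trans (cong t sk) tk) wi<wj)
    same = E-cong (λ m → cong w (sym (swap-braid i≢j j≢k i≢k m)))

  ascents-step : AscentsDifferentiate w
  ascents-step {i} {j} ij wi<wj with firstStep w
  ... | stop no-ascent _ = contradiction wi<wj (no-ascent ij)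
  ... | step {p} {q} pq wp<wq 𝔖≡ = by-position (i Finₚ.≟ p) (j Finₚ.≟ p) (q Finₚ.≟ i)
    where
    dw : IsD p q (E (w ∘ swapFin p q)) (E w)
    dw = subst (λ f → IsD p q (E (w ∘ swapFin p q)) (eval f)) (sym 𝔖≡)
               (∂-isD (adjacent⇒≢ pq) (𝔖 (w ∘ swapFin p q)))
    dG : IsD i j (E (w ∘ swapFin i j)) (eval (∂ i j (𝔖 (w ∘ swapFin i j))))
    dG = ∂-isD (adjacent⇒≢ ij) (𝔖 (w ∘ swapFin i j))
    conclude : eval (∂ i j (𝔖 (w ∘ swapFin i j))) ≗ E w → IsD i j (E (w ∘ swapFin i j)) (E w)
    conclude G≗E = isD-resp (cpᶠ dG) (cpᵍ dw) (λ _ → refl) G≗E dG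
    -- The given ascent and the one found by the search coincide, share one index in either of two
    -- ways, or are disjoint.
    by-position : Dec (i ≡ p) → Dec (j ≡ p) → Dec (q ≡ i) → IsD i j (E (w ∘ swapFin i j)) (E w)
    by-position (yes refl) _ _ = subst (λ q → IsD i q (E (w ∘ swapFin i q)) (E w)) (adjacent-unique pq ij) dw
    by-position (no _) (yes refl) _ = conclude (adjacent-ascents ij pq wi<wj wp<wq dG dw)
    by-position (no _) (no _) (yes refl) = conclude (sym ∘ adjacent-ascents pq ij wp<wq wi<wj dw dG)
    by-position (no i≢p) (no j≢p) (no q≢i) = conclude
      (commuting-ascents ij pq (i≢p ∘ sym) (j≢p ∘ sym) q≢i
        (λ { refl → i≢p (adjacent-uniqueˡ ij pq) }) wi<wj wp<wq dG dw)

ascents-differentiate : ∀ {n} (w : Fin n → Fin n) → AscentsDifferentiate w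
ascents-differentiate {n} w = go (suc (non-inversions w)) w ℕₚ.≤-refl
  where
  go : ∀ k (w : Fin n → Fin n) → non-inversions w ℕ.< k → AscentsDifferentiate w
  go (suc k) w (s≤s w≤k) = ascents-step w (λ v v<w → go k v (ℕₚ.≤-trans v<w w≤k))

-- The co-transition formula

-- For a permutation, the condition that exchanging the entries at `i` and `j` raises the number of
-- inversions by exactly one.
Cover : ∀ {n} → (Fin n → Fin n) → Fin n → Fin n → Set
Cover w i j = i Fin.< j × w i Fin.< w j × (∀ p → i Fin.< p → p Fin.< j → ¬ (w i Fin.< w p × w p Fin.< w j))

cover? : ∀ {n} (w : Fin n → Fin n) i j → Dec (Cover w i j)
cover? w i j = i Fin.<? j ×-dec w i Fin.<? w j ×-dec all? λ p →
  i Fin.<? p →-dec (p Fin.<? j →-dec ¬? (w i Fin.<? w p ×-dec w p Fin.<? w j))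

-- For a permutation: `w` agrees with w₀ before position `i`. If moreover a later entry exceeds
-- `w i`, then `i` is the first position at which they differ.
DominantBefore : ∀ {n} → (Fin n → Fin n) → Fin n → Set
DominantBefore w i = ∀ {p q} → p Fin.< i → p Fin.< q → w q Fin.< w p

coverTerm : ∀ {n} → (Fin n → Fin n) → Fin n → Fin n → Fun n
coverTerm w i j x = + ind (cover? w i j) * E (w ∘ swapFin i j) x

CoTransition : ∀ {n} → (Fin n → Fin n) → Set
CoTransition w = ∀ i → DominantBefore w i → (∃ λ j → i Fin.< j × w i Fin.< w j) →
                 ∀ x → x i * E w x ≡ sumℤ (λ j → coverTerm w i j x)

≮∧≢⇒> : ∀ {n} {a b : Fin n} → ¬ a Fin.< b → a ≢ b → b Fin.< a
≮∧≢⇒> a≮b a≢b = ℕₚ.≤∧≢⇒< (ℕₚ.≮⇒≥ a≮b) (a≢b ∘ sym ∘ Finₚ.toℕ-injective)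

<⇒≢ : ∀ {n} {a b : Fin n} → a Fin.< b → a ≢ b
<⇒≢ a<b refl = ℕₚ.<-irrefl refl a<b

>⇒≢ : ∀ {n} {a b : Fin n} → b Fin.< a → a ≢ b
>⇒≢ b<a refl = ℕₚ.<-irrefl refl b<a

lt-at : ∀ {n} (w : Fin n → Fin n) {a b c d} → a ≡ c → b ≡ d → w c Fin.< w d → w a Fin.< w b
lt-at w refl refl lt = lt

isD-ascent : ∀ {n} (u : Fin n → Fin n) {v : Fin n → Fin n} {r r′} → Adjacent r r′ → u r Fin.< u r′ →
             (∀ k → u (swapFin r r′ k) ≡ v k) → IsD r r′ (E v) (E u)
isD-ascent u {v} rr′ ur<ur′ us≗v =
  isD-resp (cp-E v) (cp-E u) (E-cong us≗v) (λ _ → refl) (ascents-differentiate u rr′ ur<ur′)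

-- At an ascent, `E u` is itself a divided difference, hence symmetric, and a second application
-- gives zero.
isD-vanishes : ∀ {n} (u : Fin n → Fin n) {r r′} → Adjacent r r′ → u r Fin.< u r′ → IsD r r′ (E u) (const 0ℤ)
isD-vanishes u rr′ ur<ur′ = isD-symmetric (cp-E u)
  (isD-image-symmetric (adjacent⇒≢ rr′) (ascents-differentiate u rr′ ur<ur′))

isD-0* : ∀ {n} {i j : Fin n} {F G : Fun n} → CongruencePreserving F → CongruencePreserving G →
         IsD i j (λ x → 0ℤ * F x) (λ x → 0ℤ * G x)
isD-0* {i = i} {j} cF cG = record
  { cpᶠ = cp-* (cp-const 0ℤ) cF ; cpᵍ = cp-* (cp-const 0ℤ) cG
  ; eq = λ x → ℤₚ.*-zeroʳ (δ i j x) }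

-- The co-transition formula with an ascent after position i

module LaterAscent {n} (w : Fin n → Fin n) (w-inj : Injective _≡_ _≡_ w) {i r r′ : Fin n}
                   (i<r : i Fin.< r) (rr′ : Adjacent r r′) (wr<wr′ : w r Fin.< w r′) where

  s = swapFin r r′
  v = w ∘ s
  r<r′ = adjacent⇒< {i = r} {r′} rr′
  i<r′ = ℕₚ.<-trans i<r r<r′
  i≢r = <⇒≢ i<r
  i≢r′ = <⇒≢ i<r′

  si : s i ≡ i
  si = swap-other i≢r i≢r′
  sr : s r ≡ r′
  sr = swap-left r r′
  sr′ : s r′ ≡ r
  sr′ = swap-right r r′
  s-below : ∀ {p} → p Fin.< r → s p ≡ p
  s-below p<r = swap-other (<⇒≢ p<r) (<⇒≢ (ℕₚ.<-trans p<r r<r′))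

  <r′⇒<r : ∀ {p : Fin n} → p Fin.< r′ → p ≢ r → p Fin.< r
  <r′⇒<r {p} p<r′ p≢r = ℕₚ.≤∧≢⇒< (ℕₚ.≤-pred (subst (toℕ p ℕ.<_) rr′ p<r′)) (p≢r ∘ Finₚ.toℕ-injective)

  between-swap : ∀ {j} → j ≢ r → j ≢ r′ → ∀ p → i Fin.< p → p Fin.< j → i Fin.< s p × s p Fin.< j
  between-swap {j} j≢r j≢r′ = swap-elim (λ p → i Fin.< p → p Fin.< j → i Fin.< s p × s p Fin.< j)
    (λ _ r<j → subst (i Fin.<_) (sym sr) i<r′ , subst (Fin._< j) (sym sr)
      (ℕₚ.≤∧≢⇒< (subst (ℕ._≤ toℕ j) (sym rr′) r<j) (j≢r′ ∘ sym ∘ Finₚ.toℕ-injective)))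
    (λ _ r′<j → subst (i Fin.<_) (sym sr′) i<r , subst (Fin._< j) (sym sr′) (ℕₚ.<-trans r<r′ r′<j))
    (λ p≢r p≢r′ i<p p<j → subst (λ q → i Fin.< q × q Fin.< j) (sym (swap-other p≢r p≢r′)) (i<p , p<j))

  -- Covers of `w` at `j` become covers of `v` at `s j`. The second component says that `r` is an
  -- ascent of `w ∘ swapFin i j`, so that the divided difference at `r` leads from the term of `v`
  -- to that of `w`.
  cover⇒ : ∀ j → Cover w i j →
           Cover v i (s j) × w (swapFin i j r) Fin.< w (swapFin i j r′)
  cover⇒ = swap-elim (λ j → Cover w i j → Cover v i (s j) × w (swapFin i j r) Fin.< w (swapFin i j r′))
    (λ (_ , wi<wr , gap) →
      subst (Cover v i) (sym sr) (i<r′ , lt-at w si sr′ wi<wr , λ p i<p p<r′ (vi<vp , vp<vr′) →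
        case-r p p<r′
          (λ { refl → ℕₚ.<-asym wr<wr′ (lt-at w (sym sr) (sym sr′) vp<vr′) })
          (λ p<r → gap p i<p p<r (lt-at w (sym si) (sym (s-below p<r)) vi<vp ,
                                  lt-at w (sym (s-below p<r)) (sym sr′) vp<vr′)))
      , lt-at w (swap-right i r) (swap-other (>⇒≢ i<r′) (>⇒≢ r<r′)) (ℕₚ.<-trans wi<wr wr<wr′))
    (λ (_ , wi<wr′ , gap) →
      subst (Cover v i) (sym sr′) (i<r , lt-at w si sr wi<wr′ , λ p i<p p<r (vi<vp , vp<vr) →
        gap p i<p (ℕₚ.<-trans p<r r<r′) (lt-at w (sym si) (sym (s-below p<r)) vi<vp ,
                                         lt-at w (sym (s-below p<r)) (sym sr) vp<vr))
      , lt-at w (swap-other (>⇒≢ i<r) (<⇒≢ r<r′)) (swap-right i r′)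
          (≮∧≢⇒> (λ wi<wr → gap r i<r r<r′ (wi<wr , wr<wr′)) (i≢r ∘ w-inj)))
    (λ {j} j≢r j≢r′ (i<j , wi<wj , gap) → let sj = swap-other j≢r j≢r′ in
      subst (Cover v i) (sym sj) (i<j , lt-at w si sj wi<wj , λ p i<p p<j (vi<vp , vp<vj) →
        let (i<sp , sp<j) = between-swap j≢r j≢r′ p i<p p<j in
        gap (s p) i<sp sp<j (lt-at w (sym si) refl vi<vp , lt-at w refl (sym sj) vp<vj))
      , lt-at w (swap-other (>⇒≢ i<r) (j≢r ∘ sym)) (swap-other (>⇒≢ i<r′) (j≢r′ ∘ sym)) wr<wr′)
    where
    case-r : ∀ {A : Set} p → p Fin.< r′ → (p ≡ r → A) → (p Fin.< r → A) → A
    case-r p p<r′ eq lt with p Finₚ.≟ r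
    ... | yes p≡r = eq p≡r
    ... | no p≢r = lt (<r′⇒<r p<r′ p≢r)

  -- `v` can have one additional cover, at `r`, corresponding to `j = r′`; it arises only for `w i`
  -- below `w r`. The conclusion makes `r` an ascent of the permutation in that term, so the divided
  -- difference annihilates the term.
  ¬cover⇒ : ∀ j → ¬ Cover w i j → Cover v i (s j) → w (swapFin i j r′) Fin.< w (swapFin i j r)
  ¬cover⇒ = swap-elim (λ j → ¬ Cover w i j → Cover v i (s j) → w (swapFin i j r′) Fin.< w (swapFin i j r))
    (λ ¬cw cv → let (_ , vi<vr′ , gap) = subst (Cover v i) sr cv in
      ⊥-elim (¬cw (i<r , lt-at w (sym si) (sym sr′) vi<vr′ , λ p i<p p<r (wi<wp , wp<wr) →
        gap p i<p (ℕₚ.<-trans p<r r<r′) (lt-at w si (s-below p<r) wi<wp , lt-at w (s-below p<r) sr′ wp<wr))))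
    (λ ¬cw cv → let (_ , vi<vr , gap) = subst (Cover v i) sr′ cv in
      lt-at w (swap-right i r′) (swap-other (>⇒≢ i<r) (<⇒≢ r<r′)) (≮∧≢⇒> (λ wr<wi →
        ¬cw (i<r′ , lt-at w (sym si) (sym sr) vi<vr , λ p i<p p<r′ (wi<wp , wp<wr′) →
          gap p i<p (<r′⇒<r p<r′ (λ { refl → ℕₚ.<-asym wr<wi wi<wp }))
            (let p<r = <r′⇒<r p<r′ (λ { refl → ℕₚ.<-asym wr<wi wi<wp }) in
             lt-at w si (s-below p<r) wi<wp , lt-at w (s-below p<r) sr wp<wr′)))
        (i≢r ∘ w-inj ∘ sym)))
    (λ {j} j≢r j≢r′ ¬cw cv → let sj = swap-other j≢r j≢r′; (i<j , vi<vj , gap) = subst (Cover v i) sj cv in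
      ⊥-elim (¬cw (i<j , lt-at w (sym si) (sym sj) vi<vj , λ p i<p p<j (wi<wp , wp<wj) →
        let (i<sp , sp<j) = between-swap j≢r j≢r′ p i<p p<j in
        gap (s p) i<sp sp<j (lt-at w si (swap-involutive r r′ p) wi<wp ,
                             lt-at w (swap-involutive r r′ p) sj wp<wj))))

  conjugate : ∀ j k → w (swapFin i j (s k)) ≡ v (swapFin i (s j) k)
  conjugate j k = cong w (sym (trans (swap-conj s (swap-injective r r′) i (s j) k)
    (cong₂ (λ a b → swapFin a b (s k)) si (swap-involutive r r′ j))))

  termwise : ∀ j → IsD r r′ (coverTerm v i (s j)) (coverTerm w i j)
  termwise j = by-cases (cover? w i j) (cover? v i (s j))
    where
    by-cases : (d : Dec (Cover w i j)) (e : Dec (Cover v i (s j))) →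
      IsD r r′ (λ x → + ind e * E (v ∘ swapFin i (s j)) x) (λ x → + ind d * E (w ∘ swapFin i j) x)
    by-cases (yes cw) (yes cv) = isD-scale 1ℤ
      (isD-ascent (w ∘ swapFin i j) rr′ (proj₂ (cover⇒ j cw)) (conjugate j))
    by-cases (yes cw) (no ¬cv) = contradiction (proj₁ (cover⇒ j cw)) ¬cv
    by-cases (no _) (no _) = isD-0* (cp-E (v ∘ swapFin i (s j))) (cp-E (w ∘ swapFin i j))
    by-cases (no ¬cw) (yes cv) = isD-resp (cp-* (cp-const 1ℤ) (cp-E (v ∘ swapFin i (s j))))
      (cp-* (cp-const 0ℤ) (cp-E (w ∘ swapFin i j)))
      (λ x → sym (ℤₚ.*-identityˡ _)) (λ _ → refl)
      (isD-vanishes (v ∘ swapFin i (s j)) rr′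
        (subst₂ Fin._<_
          (trans (cong (w ∘ swapFin i j) (sym sr)) (conjugate j r))
          (trans (cong (w ∘ swapFin i j) (sym sr′)) (conjugate j r′))
          (¬cover⇒ j ¬cw cv)))

  descend : (∀ x → x i * E v x ≡ sumℤ (λ j → coverTerm v i j x)) →
            ∀ x → x i * E w x ≡ sumℤ (λ j → coverTerm w i j x)
  descend hv = isD-unique (adjacent⇒≢ rr′)
    (isD-var i≢r i≢r′ (ascents-differentiate w rr′ wr<wr′))
    (isD-resp (cp-* (cp-var i) (cp-E v)) (cpᵍ sum-D)
      -- The sum for `v` is reindexed by `s`, to match the pairing of `j` with `s j` in `termwise`.
      -- The factor `x i` passes through the divided difference because `i` differs from `r` and
      -- `r′`.
      (λ x → sym (trans (hv x) (sumℤ-permute (λ j → coverTerm v i j x) (swapPerm r r′))))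
      (λ _ → refl) sum-D)
    where
    sum-D = isD-sum termwise

  dominant : DominantBefore w i → DominantBefore v i
  dominant dom {p} {q} p<i p<q = lt-at w refl (s-below (ℕₚ.<-trans p<i i<r)) (dom p<i
    (swap-elim (λ q → p Fin.< q → p Fin.< s q)
      (λ _ → subst (p Fin.<_) (sym sr) (ℕₚ.<-trans p<i i<r′))
      (λ _ → subst (p Fin.<_) (sym sr′) (ℕₚ.<-trans p<i i<r))
      (λ q≢r q≢r′ → subst (p Fin.<_) (sym (swap-other q≢r q≢r′))) q p<q))

  larger : (∃ λ j → i Fin.< j × w i Fin.< w j) → ∃ λ j → i Fin.< j × v i Fin.< v j
  larger (j , i<j , wi<wj) = s j ,
    swap-elim (λ j → i Fin.< j → i Fin.< s j)
      (λ _ → subst (i Fin.<_) (sym sr) i<r′) (λ _ → subst (i Fin.<_) (sym sr′) i<r)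
      (λ j≢r j≢r′ → subst (i Fin.<_) (sym (swap-other j≢r j≢r′))) j i<j ,
    lt-at w si (swap-involutive r r′ j) wi<wj

-- The co-transition formula with decreasing entries after position i

decreasing : ∀ {n} (w : Fin n → Fin n) → Injective _≡_ _≡_ w → ∀ {i : Fin n} →
             (∀ {r r′ : Fin n} → i Fin.< r → Adjacent r r′ → ¬ w r Fin.< w r′) →
             ∀ {p q} → i Fin.< p → p Fin.< q → w q Fin.< w p
decreasing {n} w w-inj {i} no-ascent {p} {q} i<p p<q = go (toℕ q ℕ.∸ suc (toℕ p)) q
    (sym (ℕₚ.m∸n+n≡m p<q))
  where
  go : ∀ d q → toℕ q ≡ d ℕ.+ suc (toℕ p) → w q Fin.< w p
  go zero q pq = ≮∧≢⇒> (no-ascent i<p pq) (adjacent⇒≢ {i = p} {q} pq ∘ w-inj)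
  go (suc d) q pq = ℕₚ.<-trans
    (≮∧≢⇒> (no-ascent i<o oq) (adjacent⇒≢ {i = o} {q} oq ∘ w-inj)) (go d o o≡)
    where
    o<n : d ℕ.+ suc (toℕ p) ℕ.< n
    o<n = ℕₚ.<-trans (ℕₚ.≤-reflexive (sym pq)) (Finₚ.toℕ<n q)
    o = Fin.fromℕ< o<n
    o≡ : toℕ o ≡ d ℕ.+ suc (toℕ p)
    o≡ = Finₚ.toℕ-fromℕ< o<n
    oq : Adjacent o q
    oq = trans pq (cong suc (sym o≡))
    i<o : i Fin.< o
    i<o = ℕₚ.<-trans i<p (ℕₚ.≤-trans (ℕₚ.m≤n+m (suc (toℕ p)) d) (ℕₚ.≤-reflexive (sym o≡)))

module DecreasingTail {n} (w : Fin n → Fin n) {i i′ : Fin n}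
    (ii′ : Adjacent i i′) (wi<wi′ : w i Fin.< w i′)
    (tail : ∀ {p q : Fin n} → i Fin.< p → p Fin.< q → w q Fin.< w p) (dom : DominantBefore w i) where

  s = swapFin i i′
  v = w ∘ s
  i<i′ = adjacent⇒< {i = i} {i′} ii′
  i≢i′ = adjacent⇒≢ {i = i} {i′} ii′
  si : s i ≡ i′
  si = swap-left i i′
  si′ : s i′ ≡ i
  si′ = swap-right i i′
  s-above : ∀ {p} → i′ Fin.< p → s p ≡ p
  s-above i′<p = swap-other (>⇒≢ (ℕₚ.<-trans i<i′ i′<p)) (>⇒≢ i′<p)

  after-i : ∀ {p} → i Fin.< p → p ≢ i′ → i′ Fin.< p
  after-i {p} i<p p≢i′ = ℕₚ.≤∧≢⇒< (subst (ℕ._≤ toℕ p) (sym ii′) i<p) (p≢i′ ∘ sym ∘ Finₚ.toℕ-injective)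

  dominant : DominantBefore v i′
  dominant {p} {q} p<i′ p<q = by-cases (p Finₚ.≟ i) (q Finₚ.≟ i′)
    where
    by-cases : Dec (p ≡ i) → Dec (q ≡ i′) → v q Fin.< v p
    by-cases (yes refl) (yes refl) = lt-at w si′ si wi<wi′
    by-cases (yes refl) (no q≢i′) =
      let i′<q = after-i p<q q≢i′ in lt-at w (s-above i′<q) si (tail i<i′ i′<q)
    by-cases (no p≢i) _ = lt-at w refl (swap-other (<⇒≢ p<i) (<⇒≢ p<i′)) (dom p<i
      (swap-elim (λ q → p Fin.< q → p Fin.< s q)
        (λ _ → subst (p Fin.<_) (sym si) p<i′) (λ _ → subst (p Fin.<_) (sym si′) p<i)
        (λ q≢i q≢i′ → subst (p Fin.<_) (sym (swap-other q≢i q≢i′))) q p<q))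
      where
      p<i : p Fin.< i
      p<i = ℕₚ.≤∧≢⇒< (ℕₚ.≤-pred (subst (toℕ p ℕ.<_) ii′ p<i′)) (p≢i ∘ Finₚ.toℕ-injective)

  -- In a decreasing tail no entry lies below a later one, so the condition on intermediate entries
  -- is automatic. What remains compares the entry at `j` with `w i`, which is also `v i′`.
  cover-shift⇒ : ∀ {j} → j ≢ i′ → Cover w i j → Cover v i′ j
  cover-shift⇒ {j} j≢i′ (i<j , wi<wj , _) = let i′<j = after-i i<j j≢i′ in
    i′<j , lt-at w si′ (s-above i′<j) wi<wj , λ p i′<p p<j (_ , vp<vj) →
      ℕₚ.<-asym (tail (ℕₚ.<-trans i<i′ i′<p) p<j) (lt-at w (sym (s-above i′<p)) (sym (s-above i′<j)) vp<vj)

  cover-shift⇐ : ∀ {j} → Cover v i′ j → Cover w i j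
  cover-shift⇐ {j} (i′<j , vi′<vj , _) =
    ℕₚ.<-trans i<i′ i′<j , lt-at w (sym si′) (sym (s-above i′<j)) vi′<vj , λ p i<p p<j (_ , wp<wj) →
      ℕₚ.<-asym (tail i<p p<j) wp<wj

  -- The cover condition is that of `v` at `i′`, the polynomial that of `w` at `i`. This agrees with
  -- `coverTerm w i` except at `i′`, where it is zero.
  shifted : Fin n → Fun n
  shifted j x = + ind (cover? v i′ j) * E (w ∘ swapFin i j) x

  split-first : ∀ x → sumℤ (λ j → coverTerm w i j x) ≡ E v x + sumℤ (λ j → shifted j x)
  split-first x = trans (sumℤ-one i′ off-i′ shifted-i′≡0) (cong (_+ sumℤ (λ j → shifted j x)) at-i′)
    where
    at-i′ : coverTerm w i i′ x ≡ E v x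
    at-i′ = trans (cong (λ m → + m * E v x) (ind-yes (cover? w i i′)
      (i<i′ , wi<wi′ , λ p i<p p<i′ _ → ℕₚ.<⇒≱ p<i′ (subst (ℕ._≤ toℕ p) (sym ii′) i<p))))
      (ℤₚ.*-identityˡ (E v x))
    shifted-i′≡0 : shifted i′ x ≡ 0ℤ
    shifted-i′≡0 = cong (λ m → + m * E v x) (ind-no (cover? v i′ i′) λ (i′<i′ , _) → ℕₚ.<-irrefl refl i′<i′)
    off-i′ : ∀ j → j ≢ i′ → coverTerm w i j x ≡ shifted j x
    off-i′ j j≢i′ = cong (λ m → + m * E (w ∘ swapFin i j) x)
      (ind-cong (cover? w i j) (cover? v i′ j) (cover-shift⇒ j≢i′) cover-shift⇐)
      where
      ind-cong : ∀ {P Q : Set} (d : Dec P) (e : Dec Q) → (P → Q) → (Q → P) → ind d ≡ ind e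
      ind-cong (yes p) e f g = sym (ind-yes e (f p))
      ind-cong (no ¬p) e f g = sym (ind-no e (¬p ∘ g))

  -- By `isD-leibniz`, the divided difference of `x i′ * E v x` is `x i * E w x - E v x`; the
  -- missing `E v x` is the term of the cover at `i′`.
  from-D : IsD i i′ (λ x → x i′ * E v x) (λ x → sumℤ (λ j → shifted j x)) →
           ∀ x → x i * E w x ≡ sumℤ (λ j → coverTerm w i j x)
  from-D d x = trans (regroup (x i * E w x) (E v x)) (trans
    (cong (λ u → E v x + u) (isD-unique i≢i′ (isD-leibniz (ascents-differentiate w ii′ wi<wi′)) d x))
    (sym (split-first x)))
    where
    regroup : ∀ a b → a ≡ b + (a - b)
    regroup = solve-∀

  conjugate : ∀ {j} → i′ Fin.< j → ∀ k → w (swapFin i j (s k)) ≡ v (swapFin i′ j k)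
  conjugate {j} i′<j k = cong w (sym (trans (swap-conj s (swap-injective i i′) i′ j k)
    (cong₂ (λ a b → swapFin a b (s k)) si′ (s-above i′<j))))

  termwise : ∀ j → IsD i i′ (coverTerm v i′ j) (shifted j)
  termwise j = by-cases (cover? v i′ j)
    where
    by-cases : (d : Dec (Cover v i′ j)) →
      IsD i i′ (λ x → + ind d * E (v ∘ swapFin i′ j) x) (λ x → + ind d * E (w ∘ swapFin i j) x)
    by-cases (no _) = isD-0* (cp-E (v ∘ swapFin i′ j)) (cp-E (w ∘ swapFin i j))
    by-cases (yes (i′<j , _)) = isD-scale 1ℤ (isD-ascent (w ∘ swapFin i j) ii′
      (lt-at w (swap-left i j) (swap-other (>⇒≢ i<i′) (<⇒≢ i′<j)) (tail i<i′ i′<j)) (conjugate i′<j))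

  descend : (∀ x → x i′ * E v x ≡ sumℤ (λ j → coverTerm v i′ j x)) →
            ∀ x → x i * E w x ≡ sumℤ (λ j → coverTerm w i j x)
  descend hv = from-D (isD-resp (cp-* (cp-var i′) (cp-E v)) (cpᵍ sum-D) (sym ∘ hv) (λ _ → refl) sum-D)
    where
    sum-D = isD-sum termwise

  no-ascents : (∀ {j} → i′ Fin.< j → ¬ v i′ Fin.< v j) → ∀ {p q} → Adjacent p q → ¬ v p Fin.< v q
  no-ascents maximal {p} {q} pq vp<vq = by-cases (p Fin.<? i′) (p Finₚ.≟ i′)
    where
    p<q = adjacent⇒< {i = p} {q} pq
    by-cases : Dec (p Fin.< i′) → Dec (p ≡ i′) → ⊥
    by-cases (yes p<i′) _ = ℕₚ.<-asym (dominant p<i′ p<q) vp<vq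
    by-cases (no _) (yes refl) = maximal p<q vp<vq
    by-cases (no p≮i′) (no p≢i′) = let i′<p = ≮∧≢⇒> p≮i′ p≢i′ in
      ℕₚ.<-asym (tail (ℕₚ.<-trans i<i′ i′<p) p<q)
        (lt-at w (sym (s-above i′<p)) (sym (s-above (ℕₚ.<-trans i′<p p<q))) vp<vq)

  -- Here `v` has no ascent, so `E v` is the staircase. Its product with `x i′` is symmetric and has
  -- divided difference zero, while `v` has no cover at `i′`: both sides of the formula reduce to
  -- `E v x`.
  base : (∀ {j} → i′ Fin.< j → ¬ v i′ Fin.< v j) → ∀ x → x i * E w x ≡ sumℤ (λ j → coverTerm w i j x)
  base maximal with firstStep v
  ... | step pq vp<vq _ = contradiction vp<vq (no-ascents maximal pq)
  ... | stop _ 𝔖v≡ = from-D (isD-resp cp-left (cp-sum (λ j → cpᵍ (termwise j))) (λ _ → refl)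
      (λ x → sym (vanish x)) (isD-symmetric cp-left invariant))
    where
    cp-left : CongruencePreserving (λ x → x i′ * E v x)
    cp-left = cp-* (cp-var i′) (cp-E v)
    vanish : ∀ x → sumℤ (λ j → shifted j x) ≡ 0ℤ
    vanish x = trans (sumℤ-cong (λ j → cong (λ m → + m * E (w ∘ swapFin i j) x)
      (ind-no (cover? v i′ j) λ (i′<j , vi′<vj , _) → maximal i′<j vi′<vj))) (sumℤ-zero n)
    invariant : ∀ x → x (s i′) * E v (x ∘ s) ≡ x i′ * E v x
    invariant x rewrite 𝔖v≡ = staircase-invariant ii′ x

-- The induction for the co-transition formula

cotransition-step : ∀ {n} (w : Fin n → Fin n) → Injective _≡_ _≡_ w →
  (∀ v → Injective _≡_ _≡_ v → non-inversions v ℕ.< non-inversions w → CoTransition v) →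
  CoTransition w
cotransition-step {n} w w-inj ih i dom (j , i<j , wi<wj)
  with any? (λ r → any? (λ r′ → i Fin.<? r ×-dec (toℕ r′ ℕ.≟ suc (toℕ r)) ×-dec w r Fin.<? w r′))
... | yes (r , r′ , i<r , rr′ , wr<wr′) = descend
    (ih v (swap-injective r r′ ∘ w-inj) (non-inversions-decrease w rr′ wr<wr′)
        i (dominant dom) (larger (j , i<j , wi<wj)))
  where open LaterAscent w w-inj i<r rr′ wr<wr′
... | no no-ascent = by-cases (any? (λ j → i′ Fin.<? j ×-dec v i′ Fin.<? v j))
  where
  tail : ∀ {p q} → i Fin.< p → p Fin.< q → w q Fin.< w p
  tail = decreasing w w-inj (λ {r} {r′} i<r rr′ wr<wr′ → no-ascent (r , r′ , i<r , rr′ , wr<wr′))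
  i′ = Fin.fromℕ< (ℕₚ.≤-<-trans i<j (Finₚ.toℕ<n j))
  ii′ : Adjacent i i′
  ii′ = Finₚ.toℕ-fromℕ< (ℕₚ.≤-<-trans i<j (Finₚ.toℕ<n j))
  -- The entries after position `i` decrease, so the first of them is at least the given `w j`.
  wi<wi′ : w i Fin.< w i′
  wi<wi′ with j Finₚ.≟ i′
  ... | yes j≡i′ = subst (λ k → w i Fin.< w k) j≡i′ wi<wj
  ... | no j≢i′ = ℕₚ.<-trans wi<wj (tail (adjacent⇒< {i = i} ii′)
    (ℕₚ.≤∧≢⇒< (subst (ℕ._≤ toℕ j) (sym ii′) i<j) (j≢i′ ∘ sym ∘ Finₚ.toℕ-injective)))
  open DecreasingTail w ii′ wi<wi′ tail dom
  by-cases : Dec (∃ λ j → i′ Fin.< j × v i′ Fin.< v j) → ∀ x → x i * E w x ≡ sumℤ (λ j → coverTerm w i j x)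
  by-cases (yes larger) = descend
    (ih v (swap-injective i i′ ∘ w-inj) (non-inversions-decrease w ii′ wi<wi′) i′ dominant larger)
  by-cases (no ¬larger) = base (λ {j} i′<j vi′<vj → ¬larger (j , i′<j , vi′<vj))

cotransition : ∀ {n} (w : Fin n → Fin n) → Injective _≡_ _≡_ w → CoTransition w
cotransition {n} w w-inj = go (suc (non-inversions w)) w w-inj ℕₚ.≤-refl
  where
  go : ∀ k (w : Fin n → Fin n) → Injective _≡_ _≡_ w → non-inversions w ℕ.< k → CoTransition w
  go (suc k) w w-inj (s≤s w≤k) =
    cotransition-step w w-inj (λ v v-inj v<w → go k v v-inj (ℕₚ.≤-trans v<w w≤k))

-- Counting 132 patterns

pattern? : ∀ {n} (w : Fin n → Fin n) p q r →
           Dec (p Fin.< q × q Fin.< r × w p Fin.< w r × w r Fin.< w q)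
pattern? w p q r = p Fin.<? q ×-dec (q Fin.<? r ×-dec (w p Fin.<? w r ×-dec w r Fin.<? w q))

patterns : ∀ {n} → (Fin n → Fin n) → ℕ
patterns w = sumℕ λ p → sumℕ λ q → sumℕ λ r → ind (pattern? w p q r)

length-filter-concatMap : ∀ {A : Set} {P : A → Set} (P? : Decidable P) {m n}
  (f : Fin m → List A) (h : Fin n → Fin m) →
  length (filter P? (concatMap f (List.tabulate h))) ≡ sumℕ λ k → length (filter P? (f (h k)))
length-filter-concatMap P? {n = zero} f h = refl
length-filter-concatMap P? {n = suc n} f h = trans
  (cong length (filter-++ P? (f (h zero)) (concatMap f (List.tabulate (h ∘ suc)))))
  (trans (length-++ (filter P? (f (h zero))))
         (cong (length (filter P? (f (h zero))) ℕ.+_) (length-filter-concatMap P? f (h ∘ suc))))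

length-filter-map : ∀ {A : Set} {P : A → Set} (P? : Decidable P) {m n}
  (f : Fin m → A) (h : Fin n → Fin m) →
  length (filter P? (List.map f (List.tabulate h))) ≡ sumℕ λ k → ind (P? (f (h k)))
length-filter-map P? {n = zero} f h = refl
length-filter-map P? {n = suc n} f h with P? (f (h zero))
... | yes _ = cong suc (length-filter-map P? f (h ∘ suc))
... | no _ = length-filter-map P? f (h ∘ suc)

triples : ∀ n → List (Fin n × Fin n × Fin n)
triples n = concatMap (λ p → concatMap (λ q → List.map (λ r → (p , q , r)) (allFin n)) (allFin n)) (allFin n)

length-filter-triples : ∀ {n} {P : Fin n × Fin n × Fin n → Set} (P? : Decidable P) →
  length (filter P? (triples n)) ≡ sumℕ λ p → sumℕ λ q → sumℕ λ r → ind (P? (p , q , r))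
length-filter-triples {n} P? = trans
  (length-filter-concatMap P?
    (λ p → concatMap (λ q → List.map (λ r → (p , q , r)) (allFin n)) (allFin n)) id)
  (sumℕ-cong λ p → trans (length-filter-concatMap P? (λ q → List.map (λ r → (p , q , r)) (allFin n)) id)
  (sumℕ-cong λ q → length-filter-map P? (λ r → (p , q , r)) id))

η≡patterns : ∀ {n} (w : Permutation′ n) → η w ≡ patterns (w ⟨$⟩ʳ_)
-- The underscore is the local test of `η`, which unfolds to `pattern?`.
η≡patterns {n} w = length-filter-triples {n} _

-- Estimates for sums and the termination measure

sumℕ-zero : ∀ {n} {f : Fin n → ℕ} → (∀ k → f k ≡ 0) → sumℕ f ≡ 0
sumℕ-zero {zero} f≡0 = refl
sumℕ-zero {suc n} f≡0 = cong₂ ℕ._+_ (f≡0 zero) (sumℕ-zero (f≡0 ∘ suc))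

term≤sumℕ : ∀ {n} (f : Fin n → ℕ) k → f k ℕ.≤ sumℕ f
term≤sumℕ f zero = ℕₚ.m≤m+n _ _
term≤sumℕ f (suc k) = ℕₚ.≤-trans (term≤sumℕ (f ∘ suc) k) (ℕₚ.m≤n+m _ _)

sumℕ-single : ∀ {n} (f : Fin n → ℕ) i → (∀ k → k ≢ i → f k ≡ 0) → sumℕ f ≡ f i
sumℕ-single f zero f≡0 = trans (cong (f zero ℕ.+_) (sumℕ-zero (λ k → f≡0 (suc k) λ ()))) (ℕₚ.+-identityʳ _)
sumℕ-single f (suc i) f≡0 = cong₂ ℕ._+_ (f≡0 zero λ ())
  (sumℕ-single (f ∘ suc) i (λ k k≢i → f≡0 (suc k) (k≢i ∘ Finₚ.suc-injective)))

-- The remainder is expressed through `g`, with zeros at `i` and `j`, so that two functions agreeing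
-- elsewhere get the same remainder and only the two split-off terms need comparison.
sumℕ-split : ∀ {n} {i j : Fin n} → i ≢ j → (f g : Fin n → ℕ) → (∀ k → k ≢ i → k ≢ j → f k ≡ g k) →
             sumℕ f ≡ f i ℕ.+ (f j ℕ.+ sumℕ (setExp i 0 j 0 g))
sumℕ-split {i = i} {j} i≢j f g f≡g = sumℕ-two i≢j
  (λ k k≢i k≢j → trans (f≡g k k≢i k≢j) (sym (setExp-other 0 0 g k≢i k≢j)))
  (setExp-left i j 0 0 g) (setExp-right i≢j 0 0 g)

two-terms≤sumℕ : ∀ {n} (f : Fin n → ℕ) {i j} → i ≢ j → f i ℕ.+ f j ℕ.≤ sumℕ f
two-terms≤sumℕ f {i} {j} i≢j = subst (f i ℕ.+ f j ℕ.≤_) (sym (sumℕ-split i≢j f f (λ _ _ _ → refl)))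
  (ℕₚ.+-monoʳ-≤ (f i) (ℕₚ.m≤m+n (f j) _))

sumℕ≤sumℤ : ∀ {n} (f : Fin n → ℕ) (g : Fin n → ℤ) → (∀ k → + f k ℤ.≤ g k) → + sumℕ f ℤ.≤ sumℤ g
sumℕ≤sumℤ {zero} f g f≤g = ℤ.+≤+ z≤n
sumℕ≤sumℤ {suc n} f g f≤g = ℤₚ.+-mono-≤ (f≤g zero) (sumℕ≤sumℤ (f ∘ suc) (g ∘ suc) (f≤g ∘ suc))

-- Measure of the final induction. It drops under every exchange of an increasing pair of entries,
-- whether or not their positions are adjacent, by the rearrangement inequality.
weight : ∀ {n} → (Fin n → Fin n) → ℕ
weight w = sumℕ λ p → toℕ p ℕ.* toℕ (w p)

-- The difference of the two sides is (b - a)(d - c); below, `suc k` is b - a.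
rearrangement : ∀ {a b c d} → a ℕ.< b → c ℕ.< d → a ℕ.* d ℕ.+ b ℕ.* c ℕ.< a ℕ.* c ℕ.+ b ℕ.* d
rearrangement {a} {b} {c} {d} a<b c<d with ℕₚ.m≤n⇒∃[o]m+o≡n a<b
... | k , refl = subst₂ ℕ._<_ (left a c d k) (right a c d k)
  (ℕₚ.+-monoʳ-< (a ℕ.* c ℕ.+ a ℕ.* d) (ℕₚ.*-monoʳ-< (suc k) c<d))
  where
  left : ∀ a c d k → a ℕ.* c ℕ.+ a ℕ.* d ℕ.+ suc k ℕ.* c ≡ a ℕ.* d ℕ.+ (suc a ℕ.+ k) ℕ.* c
  left = solve-∀ℕ
  right : ∀ a c d k → a ℕ.* c ℕ.+ a ℕ.* d ℕ.+ suc k ℕ.* d ≡ a ℕ.* c ℕ.+ (suc a ℕ.+ k) ℕ.* d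
  right = solve-∀ℕ

weight-decrease : ∀ {n} (w : Fin n → Fin n) {i j} → i Fin.< j → w i Fin.< w j →
                  weight (w ∘ swapFin i j) ℕ.< weight w
weight-decrease w {i} {j} i<j wi<wj = subst₂ ℕ._<_
  (sym (trans (sumℕ-split i≢j f′ f (λ k k≢i k≢j → cong (λ l → toℕ k ℕ.* toℕ (w l)) (swap-other k≢i k≢j)))
    (cong₂ (λ a b → toℕ i ℕ.* toℕ (w a) ℕ.+ (toℕ j ℕ.* toℕ (w b) ℕ.+ sumℕ (setExp i 0 j 0 f)))
      (swap-left i j) (swap-right i j))))
  (sym (sumℕ-split i≢j f f (λ _ _ _ → refl)))
  (subst₂ ℕ._<_ (ℕₚ.+-assoc (toℕ i ℕ.* toℕ (w j)) _ _) (ℕₚ.+-assoc (toℕ i ℕ.* toℕ (w i)) _ _)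
    (ℕₚ.+-monoˡ-< (sumℕ (setExp i 0 j 0 f)) (rearrangement i<j wi<wj)))
  where
  i≢j = <⇒≢ i<j
  f = λ p → toℕ p ℕ.* toℕ (w p)
  f′ = λ p → toℕ p ℕ.* toℕ (w (swapFin i j p))

minimise : ∀ {n} (μ : Fin n → ℕ) {P : Fin n → Set} → Decidable P → ∃ P →
           ∃ λ i → P i × (∀ {p} → μ p ℕ.< μ i → ¬ P p)
minimise μ {P} P? (i , Pi) = go (suc (μ i)) i ℕₚ.≤-refl Pi
  where
  go : ∀ k i → μ i ℕ.< k → P i → ∃ λ i → P i × (∀ {p} → μ p ℕ.< μ i → ¬ P p)
  go (suc k) i (s≤s μi≤k) Pi with any? (λ p → μ p ℕ.<? μ i ×-dec P? p)
  ... | yes (p , μp<μi , Pp) = go k p (ℕₚ.≤-trans μp<μi μi≤k) Pp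
  ... | no ¬smaller = i , Pi , λ {p} μp<μi Pp → ¬smaller (p , μp<μi , Pp)

-- The effect of a transposition on the patterns

larger-between? : ∀ {n} (w : Fin n → Fin n) (i j q : Fin n) → Dec (i Fin.< q × q Fin.< j × w i Fin.< w q)
larger-between? w i j q = i Fin.<? q ×-dec (q Fin.<? j ×-dec w i Fin.<? w q)

-- If no value lies strictly between `w i` and `w j`, this counts the patterns 132 in which these
-- two entries are the 1 and the 2.
larger-between : ∀ {n} → (Fin n → Fin n) → Fin n → Fin n → ℕ
larger-between w i j = sumℕ λ q → ind (larger-between? w i j q)

module _ {n} (w : Fin n → Fin n) (w-inj : Injective _≡_ _≡_ w) {i j : Fin n}
         (i<j : i Fin.< j) (wi<wj : w i Fin.< w j)
         (gap : ∀ p → ¬ (w i Fin.< w p × w p Fin.< w j)) where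

  -- By `gap` the entries `w i` and `w j` are neighbours in value, so every other entry is on the
  -- same side of both, and only their mutual comparison is reversed.
  value-swap-order : ∀ a b → ¬ (a ≡ i × b ≡ j) → w a Fin.< w b →
                     w (swapFin i j a) Fin.< w (swapFin i j b)
  value-swap-order = swap-elim (λ a → ∀ b → ¬ (a ≡ i × b ≡ j) → w a Fin.< w b → w (s a) Fin.< w (s b))
    (swap-elim (λ b → ¬ (i ≡ i × b ≡ j) → w i Fin.< w b → w (s i) Fin.< w (s b))
      (λ _ wi<wi → ⊥-elim (ℕₚ.<-irrefl refl wi<wi))
      (λ excluded _ → ⊥-elim (excluded (refl , refl)))
      (λ {b} b≢i b≢j _ wi<wb → lt-at w (swap-left i j) (swap-other b≢i b≢j)
        (≮∧≢⇒> (λ wb<wj → gap b (wi<wb , wb<wj)) (b≢j ∘ w-inj))))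
    (swap-elim (λ b → ¬ (j ≡ i × b ≡ j) → w j Fin.< w b → w (s j) Fin.< w (s b))
      (λ _ wj<wi → ⊥-elim (ℕₚ.<-asym wi<wj wj<wi))
      (λ _ wj<wj → ⊥-elim (ℕₚ.<-irrefl refl wj<wj))
      (λ b≢i b≢j _ wj<wb → lt-at w (swap-right i j) (swap-other b≢i b≢j) (ℕₚ.<-trans wi<wj wj<wb)))
    (λ {a} a≢i a≢j → swap-elim (λ b → ¬ (a ≡ i × b ≡ j) → w a Fin.< w b → w (s a) Fin.< w (s b))
      (λ _ wa<wi → lt-at w (swap-other a≢i a≢j) (swap-left i j) (ℕₚ.<-trans wa<wi wi<wj))
      (λ _ wa<wj → lt-at w (swap-other a≢i a≢j) (swap-right i j)
        (≮∧≢⇒> (λ wi<wa → gap a (wi<wa , wa<wj)) (a≢i ∘ sym ∘ w-inj)))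
      (λ b≢i b≢j _ → lt-at w (swap-other a≢i a≢j) (swap-other b≢i b≢j)))
    where
    s = swapFin i j

  -- Only the occurrences using w i and w j as their two smallest values are destroyed.
  patterns-value-swap : patterns w ℕ.≤ patterns (w ∘ swapFin i j) ℕ.+ larger-between w i j
  patterns-value-swap = begin
    patterns w
      ≤⟨ sumℕ-mono-≤ (λ p → sumℕ-mono-≤ λ q → sumℕ-mono-≤ λ r → pointwise p q r) ⟩
    (sumℕ λ p → sumℕ λ q → sumℕ λ r → kept p q r ℕ.+ lost p q r)
      ≡⟨ (sumℕ-cong λ p → trans (sumℕ-cong λ q → sumℕ-distrib-+ (kept p q) (lost p q))
           (sumℕ-distrib-+ (λ q → sumℕ (kept p q)) (λ q → sumℕ (lost p q)))) ⟩
    (sumℕ λ p → sumℕ (λ q → sumℕ (kept p q)) ℕ.+ sumℕ (λ q → sumℕ (lost p q)))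
      ≡⟨ sumℕ-distrib-+ (λ p → sumℕ (λ q → sumℕ (kept p q))) (λ p → sumℕ (λ q → sumℕ (lost p q))) ⟩
    patterns (w ∘ swapFin i j) ℕ.+ (sumℕ λ p → sumℕ λ q → sumℕ (lost p q))
      ≤⟨ ℕₚ.+-monoʳ-≤ (patterns (w ∘ swapFin i j)) total-lost ⟩
    patterns (w ∘ swapFin i j) ℕ.+ larger-between w i j ∎
    where
    open ℕₚ.≤-Reasoning
    kept lost : Fin n → Fin n → Fin n → ℕ
    lost? : ∀ p q r → Dec ((p ≡ i × r ≡ j) × (i Fin.< q × q Fin.< j × w i Fin.< w q))
    kept p q r = ind (pattern? (w ∘ swapFin i j) p q r)
    lost? p q r = (p Finₚ.≟ i ×-dec r Finₚ.≟ j) ×-dec larger-between? w i j q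
    lost p q r = ind (lost? p q r)
    pointwise : ∀ p q r → ind (pattern? w p q r) ℕ.≤ kept p q r ℕ.+ lost p q r
    pointwise p q r = ind-≤ (pattern? w p q r) λ (p<q , q<r , wp<wr , wr<wq) →
      by-cases (p Finₚ.≟ i ×-dec r Finₚ.≟ j) p<q q<r wp<wr wr<wq
      where
      by-cases : Dec (p ≡ i × r ≡ j) → p Fin.< q → q Fin.< r → w p Fin.< w r → w r Fin.< w q →
                 1 ℕ.≤ kept p q r ℕ.+ lost p q r
      by-cases (yes (refl , refl)) p<q q<r wp<wr wr<wq = ℕₚ.≤-trans
        (ℕₚ.≤-reflexive (sym (ind-yes (lost? p q r) ((refl , refl) , p<q , q<r , ℕₚ.<-trans wp<wr wr<wq))))
        (ℕₚ.m≤n+m _ (kept p q r))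
      by-cases (no ¬ij) p<q q<r wp<wr wr<wq = ℕₚ.≤-trans
        (ℕₚ.≤-reflexive (sym (ind-yes (pattern? (w ∘ swapFin i j) p q r)
          -- The comparison of `w r` with `w q` is never the reversed one: `r = i` and `q = j` would
          -- put `i` after `j`.
          (p<q , q<r , value-swap-order p r ¬ij wp<wr ,
           value-swap-order r q (λ { (refl , refl) → ℕₚ.<-asym i<j q<r }) wr<wq))))
        (ℕₚ.m≤m+n _ (lost p q r))
    total-lost : (sumℕ λ p → sumℕ λ q → sumℕ (lost p q)) ℕ.≤ larger-between w i j
    total-lost = begin
      (sumℕ λ p → sumℕ λ q → sumℕ (lost p q))
        ≡⟨ sumℕ-single _ i (λ p p≢i → sumℕ-zero λ q → sumℕ-zero λ r →
             ind-no (lost? p q r) λ ((p≡i , _) , _) → p≢i p≡i) ⟩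
      (sumℕ λ q → sumℕ (lost i q))
        ≡⟨ (sumℕ-cong λ q → sumℕ-single (lost i q) j λ r r≢j →
             ind-no (lost? i q r) λ ((_ , r≡j) , _) → r≢j r≡j) ⟩
      (sumℕ λ q → lost i q j)
        ≤⟨ (sumℕ-mono-≤ λ q → ind-≤ (lost? i q j) λ (_ , between) →
             ℕₚ.≤-reflexive (sym (ind-yes (larger-between? w i j q) between))) ⟩
      larger-between w i j ∎

  -- After moving w i to position f, it forms a 132 with w j and every larger entry in between.
  larger-between-bound : ∀ {f : Fin n} → i Fin.< f →
                         (∀ {p : Fin n} → p Fin.< f → ¬ (i Fin.< p × w i Fin.< w p)) → f ≢ j →
                         larger-between w i j ℕ.≤ suc (patterns (w ∘ swapFin i f))
  larger-between-bound {f} i<f first f≢j = begin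
    larger-between w i j
      ≤⟨ sumℕ-mono-≤ pointwise ⟩
    (sumℕ λ q → at-f q ℕ.+ pat q)
      ≡⟨ sumℕ-distrib-+ at-f pat ⟩
    sumℕ at-f ℕ.+ sumℕ pat
      ≡⟨ cong (ℕ._+ sumℕ pat) (trans (sumℕ-single at-f f (λ q q≢f → ind-no (q Finₚ.≟ f) q≢f))
           (ind-yes (f Finₚ.≟ f) refl)) ⟩
    suc (sumℕ pat)
      ≤⟨ s≤s (sumℕ-mono-≤ λ q → term≤sumℕ (λ r → ind (pattern? w′ f q r)) j) ⟩
    suc (sumℕ λ q → sumℕ λ r → ind (pattern? w′ f q r))
      ≤⟨ s≤s (term≤sumℕ (λ p → sumℕ λ q → sumℕ λ r → ind (pattern? w′ p q r)) f) ⟩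
    suc (patterns w′) ∎
    where
    open ℕₚ.≤-Reasoning
    w′ = w ∘ swapFin i f
    at-f pat : Fin n → ℕ
    at-f q = ind (q Finₚ.≟ f)
    pat q = ind (pattern? w′ f q j)
    pointwise : ∀ q → ind (larger-between? w i j q) ℕ.≤ at-f q ℕ.+ pat q
    pointwise q = ind-≤ (larger-between? w i j q) λ (i<q , q<j , wi<wq) → by-cases (q Finₚ.≟ f) i<q q<j wi<wq
      where
      by-cases : (d : Dec (q ≡ f)) → i Fin.< q → q Fin.< j → w i Fin.< w q → 1 ℕ.≤ ind d ℕ.+ pat q
      by-cases (yes _) _ _ _ = s≤s z≤n
      by-cases (no q≢f) i<q q<j wi<wq = ℕₚ.≤-reflexive (sym (ind-yes (pattern? w′ f q j)
        ( ≮∧≢⇒> {a = q} {f} (λ q<f → first q<f (i<q , wi<wq)) q≢f , q<j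
        , lt-at w (swap-right i f) j-fixed wi<wj
        , lt-at w j-fixed (swap-other (>⇒≢ i<q) q≢f)
            (≮∧≢⇒> (λ wq<wj → gap q (wi<wq , wq<wj)) (<⇒≢ q<j ∘ w-inj)))))
        where
        j-fixed = swap-other (>⇒≢ i<j) (f≢j ∘ sym)

-- The lower bound by induction

Larger : ∀ {n} → (Fin n → Fin n) → Fin n → Fin n → Set
Larger w i j = i Fin.< j × w i Fin.< w j

larger? : ∀ {n} (w : Fin n → Fin n) i j → Dec (Larger w i j)
larger? w i j = i Fin.<? j ×-dec w i Fin.<? w j

-- This is the case of w₀: the staircase monomial has value 1 at the all-ones point, and the 1 and
-- the 2 of a pattern 132 would be an entry with a larger later one.
no-larger : ∀ {n} (w : Fin n → Fin n) → ¬ (∃ λ i → ∃ (Larger w i)) → + suc (patterns w) ℤ.≤ E w (const 1ℤ)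
no-larger {n} w ¬larger with firstStep w
... | step {i} {j} ij wi<wj _ = contradiction (i , j , adjacent⇒< {i = i} ij , wi<wj) ¬larger
... | stop _ 𝔖≡ = ℤₚ.≤-reflexive (trans (cong (λ m → + suc m) patterns≡0)
  (sym (trans (cong (λ f → eval f (const 1ℤ)) 𝔖≡) (eval-ones (staircase n)))))
  where
  patterns≡0 : patterns w ≡ 0
  patterns≡0 = sumℕ-zero λ p → sumℕ-zero λ q → sumℕ-zero λ r → ind-no (pattern? w p q r)
    λ (p<q , q<r , wp<wr , _) → ¬larger (p , r , ℕₚ.<-trans p<q q<r , wp<wr)

patterns-bound : ∀ {n} k (w : Fin n → Fin n) → Injective _≡_ _≡_ w → weight w ℕ.< k →
                 + suc (patterns w) ℤ.≤ E w (const 1ℤ)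
patterns-bound {n} (suc k) w w-inj (s≤s w≤k) with any? (λ i → any? (larger? w i))
... | no ¬larger = no-larger w ¬larger
... | yes exists with minimise toℕ (λ i → any? (larger? w i)) exists
...   | i , larger , i-min with minimise toℕ (larger? w i) larger | minimise (toℕ ∘ w) (larger? w i) larger
...     | f , (i<f , wi<wf) , f-min | j , (i<j , wi<wj) , j-min =
  -- At the all-ones point the factor `x i` is 1, so the co-transition formula writes the value for
  -- `w` as the sum over its covers.
  subst (+ suc (patterns w) ℤ.≤_)
    (trans (sym (cotransition w w-inj i dom larger (const 1ℤ))) (ℤₚ.*-identityˡ _))
    (ℤₚ.≤-trans (ℤ.+≤+ (count (f Finₚ.≟ j))) (sumℕ≤sumℤ g (λ l → coverTerm w i l (const 1ℤ)) termwise))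
  where
  dom : DominantBefore w i
  dom {p} {q} p<i p<q = ≮∧≢⇒> (λ wp<wq → i-min p<i (q , p<q , wp<wq)) (<⇒≢ p<q ∘ w-inj)
  gap : ∀ p → ¬ (w i Fin.< w p × w p Fin.< w j)
  gap p (wi<wp , wp<wj) with i Fin.<? p
  ... | yes i<p = j-min wp<wj (i<p , wi<wp)
  -- Positions before `i` carry entries above `w j` by dominance, so `gap` holds at all positions
  -- and not only at those between `i` and `j`.
  ... | no i≮p = ℕₚ.<-asym wp<wj (dom (≮∧≢⇒> i≮p (λ { refl → ℕₚ.<-irrefl refl wi<wp }))
    (ℕₚ.≤-<-trans (ℕₚ.≮⇒≥ i≮p) i<j))
  cover-j : Cover w i j
  cover-j = i<j , wi<wj , λ p _ _ → gap p
  cover-f : Cover w i f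
  cover-f = i<f , wi<wf , λ p i<p p<f (wi<wp , _) → f-min p<f (i<p , wi<wp)
  g : Fin n → ℕ
  -- The lower bound that the induction hypothesis gives for each term; covers other than `j` and
  -- `f` enter the sum only as nonnegative terms.
  g l = ind (cover? w i l) ℕ.* suc (patterns (w ∘ swapFin i l))
  g-cover : ∀ {l} → Cover w i l → g l ≡ suc (patterns (w ∘ swapFin i l))
  g-cover {l} c = trans
    (cong (ℕ._* suc (patterns (w ∘ swapFin i l))) (ind-yes (cover? w i l) c)) (ℕₚ.*-identityˡ _)
  termwise : ∀ l → + g l ℤ.≤ coverTerm w i l (const 1ℤ)
  termwise l = by-cases (cover? w i l)
    where
    by-cases : (d : Dec (Cover w i l)) →
      + (ind d ℕ.* suc (patterns (w ∘ swapFin i l))) ℤ.≤ + ind d * E (w ∘ swapFin i l) (const 1ℤ)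
    by-cases (no _) = ℤₚ.≤-refl
    by-cases (yes (i<l , wi<wl , _)) = subst₂ ℤ._≤_
      (cong +_ (sym (ℕₚ.*-identityˡ _))) (sym (ℤₚ.*-identityˡ _))
      (patterns-bound k (w ∘ swapFin i l) (swap-injective i l ∘ w-inj)
        (ℕₚ.≤-trans (weight-decrease w i<l wi<wl) w≤k))
  open ℕₚ.≤-Reasoning
  count : Dec (f ≡ j) → suc (patterns w) ℕ.≤ sumℕ g
  count (yes refl) = begin
    suc (patterns w)
      ≤⟨ s≤s (patterns-value-swap w w-inj i<j wi<wj gap) ⟩
    suc (patterns (w ∘ swapFin i j)) ℕ.+ larger-between w i j
      -- Here `j` is itself the first larger position, so no larger entry precedes it and no pattern
      -- is lost.
      ≡⟨ cong (suc (patterns (w ∘ swapFin i j)) ℕ.+_) (sumℕ-zero λ q →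
           ind-no (larger-between? w i j q) λ (i<q , q<j , wi<wq) → f-min q<j (i<q , wi<wq)) ⟩
    suc (patterns (w ∘ swapFin i j)) ℕ.+ 0
      ≡⟨ trans (ℕₚ.+-identityʳ _) (sym (g-cover cover-j)) ⟩
    g j ≤⟨ term≤sumℕ g j ⟩
    sumℕ g ∎
  count (no f≢j) = begin
    suc (patterns w)
      ≤⟨ s≤s (patterns-value-swap w w-inj i<j wi<wj gap) ⟩
    suc (patterns (w ∘ swapFin i j)) ℕ.+ larger-between w i j
      ≤⟨ ℕₚ.+-monoʳ-≤ (suc (patterns (w ∘ swapFin i j)))
           (larger-between-bound w w-inj i<j wi<wj gap i<f f-min f≢j) ⟩
    suc (patterns (w ∘ swapFin i j)) ℕ.+ suc (patterns (w ∘ swapFin i f))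
      ≡⟨ sym (cong₂ ℕ._+_ (g-cover cover-j) (g-cover cover-f)) ⟩
    g j ℕ.+ g f ≤⟨ two-terms≤sumℕ g (f≢j ∘ sym) ⟩
    sumℕ g ∎

theorem1p1 : (n : ℕ) → 1 ≤ n → (w : Permutation′ n) → (+ η w) + (+ 1) ≤ℤ ν w
theorem1p1 n _ w = subst₂ ℤ._≤_
  (cong +_ (trans (cong suc (sym (η≡patterns w))) (ℕₚ.+-comm 1 (η w))))
  (eval-ones (schubert w))
  (patterns-bound (suc (weight (w ⟨$⟩ʳ_))) (w ⟨$⟩ʳ_) (Injection.injective (↔⇒↣ w)) ℕₚ.≤-refl)
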